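{- Let $n\in\mathbb{N}$ be such that $2n/3\in 2\mathbb{N}$ (i.e. $2n/3$ is an even natural number) and $2n/3\geq 6$. Then there exists a simple graph $G=(V,E)$ with $|V|=n$ and $$\delta(G)=\frac{2|V|}{3}-2$$ that contains an edge $x\sim y$ whose Lin-Lu-Yau curvature satisfies $\kappa(x,y)<0$.
   Context: Graphs are simple: unweighted, undirected, without multiple edges or self-loops, with nonempty vertex set. Write $x\sim y$ if $x,y\in V$ are joined by an edge. The combinatorial graph distance is $d(x,y)=\inf\{n : x=x_0\sim x_1\sim\dots\sim x_n=y\}$ (with $\inf\emptyset=\infty$). The degree $d_x$ of a vertex $x$ is its number of neighbors, and $\delta(G)=\min_{x\in V} d_x$. For probability measures $\mu_1,\mu_2$ on $V$, the Wasserstein distance is $$W_1(\mu_1,\mu_2)=\inf_{\pi\in\Pi(\mu_1,\mu_2)}\sum_{x\in V}\sum_{y\in V} d(x,y)\,\pi(x,y),$$ where $\Pi(\mu_1,\mu_2)$ is the set of $\pi:V\times V\to[0,1]$ with $\sum_{y\in V}\pi(x,y)=\mu_1(x)$ for all $x$ and $\sum_{x\in V}\pi(x,y)=\mu_2(y)$ for all $y$ (with the convention $\infty\cdot 0=0$). For $\alpha\in[0,1]$ and a vertex $x$ with $d_x\ge 1$, let $\mu_x^\alpha$ be the probability measure on $V$ given by $\mu_x^\alpha(x)=\alpha$, $\mu_x^\alpha(y)=\frac{1-\alpha}{d_x}$ if $y\sim x$, and $\mu_x^\alpha(y)=0$ otherwise. For an edge $x\sim y$, the $\alpha$-Ollivier-Ricci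 curvature is $\kappa_\alpha(x,y)=1-W_1(\mu_x^\alpha,\mu_y^\alpha)$, and the Lin-Lu-Yau curvature is $$\kappa(x,y)=\lim_{\alpha\to 1}\frac{\kappa_\alpha(x,y)}{1-\alpha}$$ (limit as $\alpha\uparrow 1$, $\alpha<1$; this limit is known to exist). -}

module Defs where

open import Data.Fin.Base as Fin using (Fin; toℕ)
open import Data.Fin.Properties as Fin using (any?; pigeonhole; toℕ<n; toℕ≤pred[n])
open import Data.Integer.Base using (+_)
open import Data.List.Base using (List; []; _∷_; length; filter; map; allFin)
open import Data.List.Extrema.Nat using (min)
open import Data.List.Membership.Propositional using (_∈_)
open import Data.List.Membership.Propositional.Properties using (∈-filter⁺; ∈-allFin)
open import Data.Nat.Base as ℕ using (ℕ; zero; suc; NonZero)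
open import Data.Nat.Induction using (<-rec)
import Data.Nat.Properties as ℕ
open import Data.Product.Base using (∃; _×_; _,_; proj₁; proj₂)
open import Data.Rational.Base as ℚ using (ℚ; 0ℚ; 1ℚ)
import Data.Rational.Properties as ℚ
open import Data.Rational.Solver using (module +-*-Solver)
open import Data.Vec.Functional using (foldr)
open import Level using (0ℓ)
open import Relation.Binary.Core using (Rel)
open import Relation.Binary.Definitions using (Decidable; Symmetric; Irreflexive)
open import Relation.Binary.PropositionalEquality
  using (_≡_; refl; sym; trans; cong; cong₂; subst)
open import Relation.Nullary.Construct.Add.Supremum using (_⁺; ⊤⁺; [_])
open import Relation.Binary.Construct.Add.Supremum.NonStrict ℕ._≤_ as ⁺ using (_≤⁺_; _≤⊤⁺)
open import Relation.Nullary.Decidable.Core using (Dec; yes; no; _×-dec_)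
open import Relation.Nullary.Negation.Core using (contradiction)
import Relation.Unary as Unary

------------------------------------------------------------------------
-- The real numbers, as Cauchy sequences of rationals up to the setoid
-- equality _≃_.  A Cauchy modulus is part of the data of a real number.

module Real where

  Eventually : (ℕ → Set) → Set
  Eventually P = ∃ λ N → ∀ n → N ℕ.≤ n → P n

  Cauchy : (ℕ → ℚ) → Set
  Cauchy f = ∀ ε .{{_ : ℚ.Positive ε}} →
    ∃ λ N → ∀ m n → N ℕ.≤ m → N ℕ.≤ n → ℚ.∣ f m ℚ.- f n ∣ ℚ.≤ ε

  record ℝ : Set where
    no-eta-equality
    field
      seq    : ℕ → ℚ
      cauchy : Cauchy seq

  open ℝ public

  private
    half : ∀ ε .{{_ : ℚ.Positive ε}} → ℚ.Positive (ε ℚ.* ℚ.½)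
    half ε = ℚ.pos*pos⇒pos ε ℚ.½

    half+half : ∀ ε → ε ℚ.* ℚ.½ ℚ.+ ε ℚ.* ℚ.½ ≡ ε
    half+half ε = trans (sym (ℚ.*-distribˡ-+ ε ℚ.½ ℚ.½)) (ℚ.*-identityʳ ε)

    +-cauchy : ∀ {f g} → Cauchy f → Cauchy g → Cauchy (λ n → f n ℚ.+ g n)
    +-cauchy {f} {g} F G ε with F (ε ℚ.* ℚ.½) {{half ε}} | G (ε ℚ.* ℚ.½) {{half ε}}
    ... | M , F′ | N , G′ = M ℕ.⊔ N , λ m n m≥ n≥ → begin
      ℚ.∣ (f m ℚ.+ g m) ℚ.- (f n ℚ.+ g n) ∣
        ≡⟨ cong ℚ.∣_∣ (rearrange (f m) (g m) (f n) (g n)) ⟩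
      ℚ.∣ (f m ℚ.- f n) ℚ.+ (g m ℚ.- g n) ∣
        ≤⟨ ℚ.∣p+q∣≤∣p∣+∣q∣ (f m ℚ.- f n) (g m ℚ.- g n) ⟩
      ℚ.∣ f m ℚ.- f n ∣ ℚ.+ ℚ.∣ g m ℚ.- g n ∣
        ≤⟨ ℚ.+-mono-≤ (F′ m n (ℕ.m⊔n≤o⇒m≤o M N m≥) (ℕ.m⊔n≤o⇒m≤o M N n≥))
                      (G′ m n (ℕ.m⊔n≤o⇒n≤o M N m≥) (ℕ.m⊔n≤o⇒n≤o M N n≥)) ⟩
      ε ℚ.* ℚ.½ ℚ.+ ε ℚ.* ℚ.½
        ≡⟨ half+half ε ⟩
      ε ∎
      where
      open ℚ.≤-Reasoning
      open +-*-Solver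
      rearrange : ∀ a b c d → (a ℚ.+ b) ℚ.- (c ℚ.+ d) ≡ (a ℚ.- c) ℚ.+ (b ℚ.- d)
      rearrange = solve 4 (λ a b c d → (a :+ b) :- (c :+ d) := (a :- c) :+ (b :- d)) refl

    neg-cauchy : ∀ {f} → Cauchy f → Cauchy (λ n → ℚ.- f n)
    neg-cauchy {f} F ε with F ε
    ... | N , F′ = N , λ m n m≥ n≥ → begin
      ℚ.∣ (ℚ.- f m) ℚ.- (ℚ.- f n) ∣  ≡⟨ cong ℚ.∣_∣ (rearrange (f m) (f n)) ⟩
      ℚ.∣ f n ℚ.- f m ∣              ≤⟨ F′ n m n≥ m≥ ⟩
      ε                              ∎
      where
      open ℚ.≤-Reasoning
      open +-*-Solver
      rearrange : ∀ a b → (ℚ.- a) ℚ.- (ℚ.- b) ≡ b ℚ.- a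
      rearrange = solve 2 (λ a b → (:- a) :- (:- b) := b :- a) refl

    cauchy-bounded : ∀ {f} → Cauchy f →
      ∃ λ B → ℚ.Positive B × Eventually (λ n → ℚ.∣ f n ∣ ℚ.≤ B)
    cauchy-bounded {f} F with F 1ℚ
    ... | N , F′ =
      1ℚ ℚ.+ ℚ.∣ f N ∣
      , ℚ.pos+nonNeg⇒pos 1ℚ ℚ.∣ f N ∣ {{ℚ.∣-∣-nonNeg (f N)}}
      , N , λ n n≥ → begin
        ℚ.∣ f n ∣                          ≡⟨ cong ℚ.∣_∣ (rearrange (f n) (f N)) ⟩
        ℚ.∣ (f n ℚ.- f N) ℚ.+ f N ∣        ≤⟨ ℚ.∣p+q∣≤∣p∣+∣q∣ (f n ℚ.- f N) (f N) ⟩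
        ℚ.∣ f n ℚ.- f N ∣ ℚ.+ ℚ.∣ f N ∣    ≤⟨ ℚ.+-monoˡ-≤ ℚ.∣ f N ∣ (F′ n N n≥ ℕ.≤-refl) ⟩
        1ℚ ℚ.+ ℚ.∣ f N ∣                   ∎
      where
      open ℚ.≤-Reasoning
      open +-*-Solver
      rearrange : ∀ a b → a ≡ (a ℚ.- b) ℚ.+ b
      rearrange = solve 2 (λ a b → a := (a :- b) :+ b) refl

    *-mono-≤ : ∀ {p q r s} → .{{ℚ.NonNegative q}} → .{{ℚ.NonNegative r}} →
               p ℚ.≤ q → r ℚ.≤ s → p ℚ.* r ℚ.≤ q ℚ.* s
    *-mono-≤ {p} {q} {r} {s} p≤q r≤s =
      ℚ.≤-trans (ℚ.*-monoʳ-≤-nonNeg r p≤q) (ℚ.*-monoˡ-≤-nonNeg q r≤s)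

    product-cauchy : ∀ {f g} A B → ℚ.Positive A → ℚ.Positive B →
      Eventually (λ n → ℚ.∣ f n ∣ ℚ.≤ A) → Eventually (λ n → ℚ.∣ g n ∣ ℚ.≤ B) →
      Cauchy f → Cauchy g → Cauchy (λ n → f n ℚ.* g n)
    product-cauchy {f} {g} A B A>0 B>0 (K , f≤A) (L , g≤B) F G ε =
      combine (F δ {{δ>0}}) (G δ {{δ>0}})
      where
      open ℚ.≤-Reasoning
      open +-*-Solver

      A+B>0 : ℚ.Positive (A ℚ.+ B)
      A+B>0 = ℚ.pos+pos⇒pos A {{A>0}} B {{B>0}}

      A+B≢0 : ℚ.NonZero (A ℚ.+ B)
      A+B≢0 = ℚ.pos⇒nonZero (A ℚ.+ B) {{A+B>0}}

      i δ : ℚ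
      i = (ℚ.1/ (A ℚ.+ B)) {{A+B≢0}}
      δ = ε ℚ.* i

      δ>0 : ℚ.Positive δ
      δ>0 = ℚ.pos*pos⇒pos ε i {{ℚ.1/pos⇒pos (A ℚ.+ B) {{A+B>0}}}}

      rearrange : ∀ a b c d → a ℚ.* b ℚ.- c ℚ.* d ≡ a ℚ.* (b ℚ.- d) ℚ.+ d ℚ.* (a ℚ.- c)
      rearrange = solve 4 (λ a b c d → a :* b :- c :* d := a :* (b :- d) :+ d :* (a :- c)) refl

      collect : ∀ a b e j → a ℚ.* (e ℚ.* j) ℚ.+ b ℚ.* (e ℚ.* j) ≡ e ℚ.* (j ℚ.* (a ℚ.+ b))
      collect = solve 4 (λ a b e j → a :* (e :* j) :+ b :* (e :* j) := e :* (j :* (a :+ b))) refl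

      total : A ℚ.* δ ℚ.+ B ℚ.* δ ≡ ε
      total = trans (collect A B ε i)
        (trans (cong (ε ℚ.*_) (ℚ.*-inverseˡ (A ℚ.+ B) {{A+B≢0}})) (ℚ.*-identityʳ ε))

      bound : ∀ a b c d → ℚ.∣ a ∣ ℚ.≤ A → ℚ.∣ d ∣ ℚ.≤ B →
              ℚ.∣ a ℚ.- c ∣ ℚ.≤ δ → ℚ.∣ b ℚ.- d ∣ ℚ.≤ δ →
              ℚ.∣ a ℚ.* b ℚ.- c ℚ.* d ∣ ℚ.≤ ε
      bound a b c d a≤A d≤B ac≤δ bd≤δ = begin
        ℚ.∣ a ℚ.* b ℚ.- c ℚ.* d ∣
          ≡⟨ cong ℚ.∣_∣ (rearrange a b c d) ⟩
        ℚ.∣ a ℚ.* (b ℚ.- d) ℚ.+ d ℚ.* (a ℚ.- c) ∣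
          ≤⟨ ℚ.∣p+q∣≤∣p∣+∣q∣ (a ℚ.* (b ℚ.- d)) (d ℚ.* (a ℚ.- c)) ⟩
        ℚ.∣ a ℚ.* (b ℚ.- d) ∣ ℚ.+ ℚ.∣ d ℚ.* (a ℚ.- c) ∣
          ≡⟨ cong₂ ℚ._+_ (ℚ.∣p*q∣≡∣p∣*∣q∣ a (b ℚ.- d)) (ℚ.∣p*q∣≡∣p∣*∣q∣ d (a ℚ.- c)) ⟩
        ℚ.∣ a ∣ ℚ.* ℚ.∣ b ℚ.- d ∣ ℚ.+ ℚ.∣ d ∣ ℚ.* ℚ.∣ a ℚ.- c ∣
          ≤⟨ ℚ.+-mono-≤
               (*-mono-≤ {{ℚ.pos⇒nonNeg A {{A>0}}}} {{ℚ.∣-∣-nonNeg (b ℚ.- d)}} a≤A bd≤δ)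
               (*-mono-≤ {{ℚ.pos⇒nonNeg B {{B>0}}}} {{ℚ.∣-∣-nonNeg (a ℚ.- c)}} d≤B ac≤δ) ⟩
        A ℚ.* δ ℚ.+ B ℚ.* δ
          ≡⟨ total ⟩
        ε ∎

      combine : (∃ λ M → ∀ m n → M ℕ.≤ m → M ℕ.≤ n → ℚ.∣ f m ℚ.- f n ∣ ℚ.≤ δ) →
                (∃ λ N → ∀ m n → N ℕ.≤ m → N ℕ.≤ n → ℚ.∣ g m ℚ.- g n ∣ ℚ.≤ δ) →
                ∃ λ N → ∀ m n → N ℕ.≤ m → N ℕ.≤ n →
                  ℚ.∣ f m ℚ.* g m ℚ.- f n ℚ.* g n ∣ ℚ.≤ ε
      combine (M , F′) (N , G′) = (K ℕ.⊔ L) ℕ.⊔ (M ℕ.⊔ N) , λ m n m≥ n≥ →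
        let m≥KL = ℕ.m⊔n≤o⇒m≤o (K ℕ.⊔ L) (M ℕ.⊔ N) m≥
            n≥KL = ℕ.m⊔n≤o⇒m≤o (K ℕ.⊔ L) (M ℕ.⊔ N) n≥
            m≥MN = ℕ.m⊔n≤o⇒n≤o (K ℕ.⊔ L) (M ℕ.⊔ N) m≥
            n≥MN = ℕ.m⊔n≤o⇒n≤o (K ℕ.⊔ L) (M ℕ.⊔ N) n≥
        in bound (f m) (g m) (f n) (g n)
             (f≤A m (ℕ.m⊔n≤o⇒m≤o K L m≥KL))
             (g≤B n (ℕ.m⊔n≤o⇒n≤o K L n≥KL))
             (F′ m n (ℕ.m⊔n≤o⇒m≤o M N m≥MN) (ℕ.m⊔n≤o⇒m≤o M N n≥MN))
             (G′ m n (ℕ.m⊔n≤o⇒n≤o M N m≥MN) (ℕ.m⊔n≤o⇒n≤o M N n≥MN))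

    *-cauchy : ∀ {f g} → Cauchy f → Cauchy g → Cauchy (λ n → f n ℚ.* g n)
    *-cauchy {f} {g} F G =
      let A , A>0 , f≤A = cauchy-bounded F
          B , B>0 , g≤B = cauchy-bounded G
      in product-cauchy {f} {g} A B A>0 B>0 f≤A g≤B F G

  infix  8 -_
  infixl 7 _*_
  infixl 6 _+_ _-_
  infix  4 _≃_ _≤_ _<_

  -- The operations are defined by copatterns, so that they unfold only
  -- under seq and cauchy.

  fromℚ : ℚ → ℝ
  seq    (fromℚ q) _ = q
  cauchy (fromℚ q) ε =
    0 , λ _ _ _ _ → subst (ℚ._≤ ε) (sym (cong ℚ.∣_∣ (ℚ.+-inverseʳ q)))
                          (ℚ.<⇒≤ (ℚ.positive⁻¹ ε))

  fromℕ : ℕ → ℝ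
  fromℕ k = fromℚ (+ k ℚ./ 1)

  0ℝ 1ℝ : ℝ
  0ℝ = fromℚ 0ℚ
  1ℝ = fromℚ 1ℚ

  _+_ : ℝ → ℝ → ℝ
  seq    (x + y) n = seq x n ℚ.+ seq y n
  cauchy (x + y)   = +-cauchy {seq x} {seq y} (cauchy x) (cauchy y)

  -_ : ℝ → ℝ
  seq    (- x) n = ℚ.- seq x n
  cauchy (- x)   = neg-cauchy {seq x} (cauchy x)

  _-_ : ℝ → ℝ → ℝ
  x - y = x + (- y)

  _*_ : ℝ → ℝ → ℝ
  seq    (x * y) n = seq x n ℚ.* seq y n
  cauchy (x * y)   = *-cauchy {seq x} {seq y} (cauchy x) (cauchy y)

  record _≤_ (x y : ℝ) : Set where
    constructor mk≤
    field
      eventually-≤ : ∀ ε .{{_ : ℚ.Positive ε}} →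
        Eventually λ n → seq x n ℚ.≤ seq y n ℚ.+ ε

  record _≃_ (x y : ℝ) : Set where
    constructor mk≃
    field
      eventually-close : ∀ ε .{{_ : ℚ.Positive ε}} →
        Eventually λ n → ℚ.∣ seq x n ℚ.- seq y n ∣ ℚ.≤ ε

  record _<_ (x y : ℝ) : Set where
    constructor mk<
    field
      gap            : ℚ
      gap-positive   : ℚ.Positive gap
      eventually-gap : Eventually λ n → gap ℚ.≤ seq y n ℚ.- seq x n

  open _≤_ public
  open _≃_ public
  open _<_ public

  x<y⇒0<y-x : ∀ {x y} → x < y → 0ℝ < y - x
  x<y⇒0<y-x {x} {y} (mk< q q>0 (N , q≤)) = mk< q q>0 (N , λ n n≥ →
    subst (q ℚ.≤_) (sym (ℚ.+-identityʳ (seq y n ℚ.- seq x n))) (q≤ n n≥))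

  -- In 1/x the sequence of x is shifted to start where its terms are known
  -- to be at least q > 0; the shift does not change the real number.
  module Reciprocal (x : ℝ) (0<x : 0ℝ < x) where
    private
      q : ℚ
      q = gap 0<x

      q>0 : ℚ.Positive q
      q>0 = gap-positive 0<x

      N : ℕ
      N = proj₁ (eventually-gap 0<x)

    t : ℕ → ℚ
    t n = seq x (N ℕ.+ n)

    q≤t : ∀ n → q ℚ.≤ t n
    q≤t n = subst (q ℚ.≤_) (ℚ.+-identityʳ (t n))
              (proj₂ (eventually-gap 0<x) (N ℕ.+ n) (ℕ.m≤m+n N n))

    t>0 : ∀ n → ℚ.Positive (t n)
    t>0 n = ℚ.positive (ℚ.<-≤-trans (ℚ.positive⁻¹ q {{q>0}}) (q≤t n))

    t≢0 : ∀ n → ℚ.NonZero (t n)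
    t≢0 n = ℚ.pos⇒nonZero (t n) {{t>0 n}}

    q≢0 : ℚ.NonZero q
    q≢0 = ℚ.pos⇒nonZero q {{q>0}}

    1/t : ℕ → ℚ
    1/t n = (ℚ.1/ t n) {{t≢0 n}}

    1/t≥0 : ∀ n → ℚ.NonNegative (1/t n)
    1/t≥0 n = ℚ.pos⇒nonNeg (1/t n) {{ℚ.1/pos⇒pos (t n) {{t>0 n}}}}

    q/t≤1 : ∀ n → q ℚ.* 1/t n ℚ.≤ 1ℚ
    q/t≤1 n = ℚ.≤-trans
      (ℚ.*-monoʳ-≤-nonNeg (1/t n) {{1/t≥0 n}} (q≤t n))
      (ℚ.≤-reflexive (ℚ.*-inverseʳ (t n) {{t≢0 n}}))

    1/q : ℚ
    1/q = (ℚ.1/ q) {{q≢0}}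

    1/q≥0 : ℚ.NonNegative 1/q
    1/q≥0 = ℚ.pos⇒nonNeg 1/q {{ℚ.1/pos⇒pos q {{q>0}}}}

    1/t≤1/q : ∀ n → 1/t n ℚ.≤ 1/q
    1/t≤1/q n = begin
      1/t n                    ≡⟨ sym (ℚ.*-identityˡ (1/t n)) ⟩
      1ℚ ℚ.* 1/t n             ≡⟨ cong (ℚ._* 1/t n) (sym (ℚ.*-inverseˡ q {{q≢0}})) ⟩
      (1/q ℚ.* q) ℚ.* 1/t n    ≡⟨ ℚ.*-assoc 1/q q (1/t n) ⟩
      1/q ℚ.* (q ℚ.* 1/t n)    ≤⟨ ℚ.*-monoˡ-≤-nonNeg 1/q {{1/q≥0}} (q/t≤1 n) ⟩
      1/q ℚ.* 1ℚ               ≡⟨ ℚ.*-identityʳ 1/q ⟩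
      1/q                      ∎
      where open ℚ.≤-Reasoning

    -- 1/a − 1/b = (b − a) · (1/a) · (1/b)
    difference : ∀ m n → 1/t m ℚ.- 1/t n ≡ (t n ℚ.- t m) ℚ.* (1/t m ℚ.* 1/t n)
    difference m n = begin
      1/t m ℚ.- 1/t n
        ≡⟨ cong₂ ℚ._-_ (sym (ℚ.*-identityʳ (1/t m))) (sym (ℚ.*-identityʳ (1/t n))) ⟩
      1/t m ℚ.* 1ℚ ℚ.- 1/t n ℚ.* 1ℚ
        ≡⟨ cong₂ (λ u v → 1/t m ℚ.* u ℚ.- 1/t n ℚ.* v)
             (sym (ℚ.*-inverseʳ (t n) {{t≢0 n}})) (sym (ℚ.*-inverseʳ (t m) {{t≢0 m}})) ⟩
      1/t m ℚ.* (t n ℚ.* 1/t n) ℚ.- 1/t n ℚ.* (t m ℚ.* 1/t m)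
        ≡⟨ collect (t m) (t n) (1/t m) (1/t n) ⟩
      (t n ℚ.- t m) ℚ.* (1/t m ℚ.* 1/t n) ∎
      where
      open Relation.Binary.PropositionalEquality.≡-Reasoning
      open +-*-Solver
      collect : ∀ a b i j → i ℚ.* (b ℚ.* j) ℚ.- j ℚ.* (a ℚ.* i) ≡ (b ℚ.- a) ℚ.* (i ℚ.* j)
      collect = solve 4 (λ a b i j → i :* (b :* j) :- j :* (a :* i) := (b :- a) :* (i :* j)) refl

    cauchy-recip : Cauchy 1/t
    cauchy-recip ε
      with cauchy x (ε ℚ.* (q ℚ.* q))
             {{ℚ.pos*pos⇒pos ε (q ℚ.* q) {{ℚ.pos*pos⇒pos q {{q>0}} q {{q>0}}}}}}
    ... | M , X = M , λ m n m≥ n≥ → begin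
      ℚ.∣ 1/t m ℚ.- 1/t n ∣
        ≡⟨ cong ℚ.∣_∣ (difference m n) ⟩
      ℚ.∣ (t n ℚ.- t m) ℚ.* (1/t m ℚ.* 1/t n) ∣
        ≡⟨ ℚ.∣p*q∣≡∣p∣*∣q∣ (t n ℚ.- t m) (1/t m ℚ.* 1/t n) ⟩
      ℚ.∣ t n ℚ.- t m ∣ ℚ.* ℚ.∣ 1/t m ℚ.* 1/t n ∣
        ≡⟨ cong (ℚ.∣ t n ℚ.- t m ∣ ℚ.*_) (ℚ.0≤p⇒∣p∣≡p (ℚ.nonNegative⁻¹ _ {{prod≥0 m n}})) ⟩
      ℚ.∣ t n ℚ.- t m ∣ ℚ.* (1/t m ℚ.* 1/t n)
        ≤⟨ *-mono-≤ {{εqq≥0}} {{prod≥0 m n}}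
             (X (N ℕ.+ n) (N ℕ.+ m) (ℕ.m≤n⇒m≤o+n N n≥) (ℕ.m≤n⇒m≤o+n N m≥))
             (*-mono-≤ {{1/q≥0}} {{1/t≥0 n}} (1/t≤1/q m) (1/t≤1/q n)) ⟩
      (ε ℚ.* (q ℚ.* q)) ℚ.* (1/q ℚ.* 1/q)
        ≡⟨ collect ε q 1/q ⟩
      ε ℚ.* ((q ℚ.* 1/q) ℚ.* (q ℚ.* 1/q))
        ≡⟨ cong (λ u → ε ℚ.* (u ℚ.* u)) (ℚ.*-inverseʳ q {{q≢0}}) ⟩
      ε ℚ.* (1ℚ ℚ.* 1ℚ)
        ≡⟨ ℚ.*-identityʳ ε ⟩
      ε ∎
      where
      open ℚ.≤-Reasoning
      open +-*-Solver
      prod≥0 : ∀ m n → ℚ.NonNegative (1/t m ℚ.* 1/t n)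
      prod≥0 m n = ℚ.nonNeg*nonNeg⇒nonNeg (1/t m) {{1/t≥0 m}} (1/t n) {{1/t≥0 n}}
      εqq≥0 : ℚ.NonNegative (ε ℚ.* (q ℚ.* q))
      εqq≥0 = ℚ.pos⇒nonNeg (ε ℚ.* (q ℚ.* q))
                {{ℚ.pos*pos⇒pos ε (q ℚ.* q) {{ℚ.pos*pos⇒pos q {{q>0}} q {{q>0}}}}}}
      collect : ∀ e a i → (e ℚ.* (a ℚ.* a)) ℚ.* (i ℚ.* i) ≡ e ℚ.* ((a ℚ.* i) ℚ.* (a ℚ.* i))
      collect = solve 3 (λ e a i → (e :* (a :* a)) :* (i :* i) := e :* ((a :* i) :* (a :* i))) refl

  recip : (x : ℝ) → 0ℝ < x → ℝ
  seq    (recip x 0<x) = Reciprocal.1/t x 0<x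
  cauchy (recip x 0<x) = Reciprocal.cauchy-recip x 0<x

  ∑ : ∀ {n} → (Fin n → ℝ) → ℝ
  ∑ = foldr _+_ 0ℝ

open Real using (ℝ; fromℚ; fromℕ; 0ℝ; 1ℝ; recip; x<y⇒0<y-x; ∑)

------------------------------------------------------------------------
-- Graphs

record SimpleGraph (n : ℕ) : Set₁ where
  infix 4 _∼_ _∼?_
  field
    {{nonempty}} : NonZero n
    _∼_          : Rel (Fin n) 0ℓ
    _∼?_         : Decidable _∼_
    symmetric    : Symmetric _∼_
    irreflexive  : Irreflexive _≡_ _∼_

  V : Set
  V = Fin n

  neighbours : V → List V
  neighbours x = filter (x ∼?_) (allFin n)

  degree : V → ℕ
  degree x = length (neighbours x)

  -- Every degree is less than n, so the starting value n of the minimum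
  -- is never attained.
  minDegree : ℕ
  minDegree = min n (map degree (allFin n))

  degree≢0 : ∀ {x y} → x ∼ y → NonZero (degree x)
  degree≢0 {x} {y} x∼y = nonZero (∈-filter⁺ (x ∼?_) (∈-allFin y) x∼y)
    where
    nonZero : ∀ {xs : List V} → y ∈ xs → NonZero (length xs)
    nonZero {_ ∷ _} _ = _

  Walk : ℕ → V → V → Set
  Walk zero    x y = x ≡ y
  Walk (suc k) x y = ∃ λ z → x ∼ z × Walk k z y

  walk? : ∀ k x y → Dec (Walk k x y)
  walk? zero    x y = x Fin.≟ y
  walk? (suc k) x y = any? λ z → (x ∼? z) ×-dec walk? k z y

-- Infimum in ℕ ∪ {∞} of a set of natural numbers; ∞ is written ⊤⁺.
IsInfimumℕ : (ℕ → Set) → ℕ ⁺ → Set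
IsInfimumℕ P m = (∀ k → P k → m ≤⁺ [ k ])
               × (∀ l → (∀ k → P k → l ≤⁺ [ k ]) → l ≤⁺ m)

-- The least element of P among k, k + 1, …, k + b - 1, or ∞.
least : ∀ {P : ℕ → Set} → Unary.Decidable P → ℕ → ℕ → ℕ ⁺
least P? zero    k = ⊤⁺
least P? (suc b) k with P? k
... | yes _ = [ k ]
... | no  _ = least P? b (suc k)

module _ {P : ℕ → Set} (P? : Unary.Decidable P) where

  least-lower : ∀ b k j → k ℕ.≤ j → j ℕ.< k ℕ.+ b → P j → least P? b k ≤⁺ [ j ]
  least-lower zero    k j k≤j j<k+0 p =
    contradiction (subst (j ℕ.<_) (ℕ.+-identityʳ k) j<k+0) (ℕ.≤⇒≯ k≤j)
  least-lower (suc b) k j k≤j j<k+b p with P? k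
  ... | yes _  = ⁺.[ k≤j ]
  ... | no ¬p = least-lower b (suc k) j
                  (ℕ.≤∧≢⇒< k≤j λ k≡j → ¬p (subst P (sym k≡j) p))
                  (subst (j ℕ.<_) (ℕ.+-suc k b) j<k+b) p

  least-greatest : ∀ b k l → (∀ j → P j → l ≤⁺ [ j ]) → l ≤⁺ least P? b k
  least-greatest zero    k l l≤ = l ≤⊤⁺
  least-greatest (suc b) k l l≤ with P? k
  ... | yes p = l≤ k p
  ... | no  _ = least-greatest b (suc k) l l≤

module _ {n : ℕ} (G : SimpleGraph n) where
  open SimpleGraph G

  -- Only walks of length less than n are searched; distance-isInfimum
  -- shows that this computes the infimum over all walks.
  distance : V → V → ℕ ⁺
  distance x y = least (λ k → walk? k x y) n 0

  private
    vertex : ∀ {x y} k → Walk k x y → Fin (suc k) → V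
    vertex {x} k       w           Fin.zero    = x
    vertex     (suc k) (_ , _ , w) (Fin.suc i) = vertex k w i

    prefix : ∀ {x y} k (w : Walk k x y) i → Walk (toℕ i) x (vertex k w i)
    prefix k       w           Fin.zero    = refl
    prefix (suc k) (_ , e , w) (Fin.suc i) = _ , e , prefix k w i

    suffix : ∀ {x y} k (w : Walk k x y) i → Walk (k ℕ.∸ toℕ i) (vertex k w i) y
    suffix k       w           Fin.zero    = w
    suffix (suc k) (_ , _ , w) (Fin.suc i) = suffix k w i

    _++_ : ∀ {k l x y z} → Walk k x y → Walk l y z → Walk (k ℕ.+ l) x z
    _++_ {zero}  refl        w = w
    _++_ {suc k} (_ , e , v) w = _ , e , _++_ {k} v w

    shorten : ∀ {x y} k → n ℕ.≤ k → Walk k x y → ∃ λ j → j ℕ.< k × Walk j x y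
    shorten {x} {y} k n≤k w with pigeonhole (ℕ.s≤s n≤k) (vertex k w)
    ... | i , j , i<j , vᵢ≡vⱼ =
      toℕ i ℕ.+ (k ℕ.∸ toℕ j)
      , ℕ.<-≤-trans (ℕ.+-monoˡ-< (k ℕ.∸ toℕ j) i<j)
                    (ℕ.≤-reflexive (ℕ.m+[n∸m]≡n (toℕ≤pred[n] j)))
      , _++_ {toℕ i} (prefix k w i)
             (subst (λ v → Walk (k ℕ.∸ toℕ j) v y) (sym vᵢ≡vⱼ) (suffix k w j))

    short-walk : ∀ {x y} k → Walk k x y → ∃ λ j → j ℕ.< n × j ℕ.≤ k × Walk j x y
    short-walk {x} {y} = <-rec _ step
      where
      step : ∀ k → (∀ {l} → l ℕ.< k → Walk l x y → ∃ λ j → j ℕ.< n × j ℕ.≤ l × Walk j x y) →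
             Walk k x y → ∃ λ j → j ℕ.< n × j ℕ.≤ k × Walk j x y
      step k ih w with k ℕ.<? n
      ... | yes k<n = k , k<n , ℕ.≤-refl , w
      ... | no  k≮n with shorten k (ℕ.≮⇒≥ k≮n) w
      ...   | l , l<k , w′ with ih l<k w′
      ...     | j , j<n , j≤l , w″ = j , j<n , ℕ.≤-trans j≤l (ℕ.<⇒≤ l<k) , w″

    weaken : ∀ {m : ℕ ⁺} {j k} → m ≤⁺ [ j ] → j ℕ.≤ k → m ≤⁺ [ k ]
    weaken ⁺.[ m≤j ] j≤k = ⁺.[ ℕ.≤-trans m≤j j≤k ]

  distance-isInfimum : ∀ x y → IsInfimumℕ (λ k → Walk k x y) (distance x y)
  distance-isInfimum x y = lower , least-greatest (λ k → walk? k x y) n 0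
    where
    lower : ∀ k → Walk k x y → distance x y ≤⁺ [ k ]
    lower k w with short-walk k w
    ... | j , j<n , j≤k , w′ =
      weaken (least-lower (λ k → walk? k x y) n 0 j ℕ.z≤n j<n w′) j≤k

------------------------------------------------------------------------
-- Optimal transport and curvature

  record Coupling (μ₁ μ₂ : V → ℝ) : Set where
    field
      π         : V → V → ℝ
      π≥0       : ∀ x y → 0ℝ Real.≤ π x y
      π≤1       : ∀ x y → π x y Real.≤ 1ℝ
      marginal₁ : ∀ x → ∑ (λ y → π x y) Real.≃ μ₁ x
      marginal₂ : ∀ y → ∑ (λ x → π x y) Real.≃ μ₂ y

  open Coupling public

  FiniteCost : ∀ {μ₁ μ₂} → Coupling μ₁ μ₂ → Set
  FiniteCost c = ∀ x y → distance x y ≡ ⊤⁺ → π c x y Real.≃ 0ℝ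

  -- d · p, where the value at d = ∞ is only meaningful for p = 0 (∞ · 0 = 0).
  _·_ : ℕ ⁺ → ℝ → ℝ
  [ d ] · p = fromℕ d Real.* p
  ⊤⁺    · p = 0ℝ

  cost : ∀ {μ₁ μ₂} → Coupling μ₁ μ₂ → ℝ
  cost c = ∑ λ x → ∑ λ y → distance x y · π c x y

  -- w is the infimum of the transport costs.  Couplings of infinite cost
  -- do not affect a finite infimum and are left out.
  IsW₁ : (μ₁ μ₂ : V → ℝ) → ℝ → Set
  IsW₁ μ₁ μ₂ w =
      (∀ (c : Coupling μ₁ μ₂) → FiniteCost c → w Real.≤ cost c)
    × (∀ ε → 0ℝ Real.< ε →
         ∃ λ (c : Coupling μ₁ μ₂) → FiniteCost c × cost c Real.< w Real.+ ε)

  μ : ℝ → (x : V) .{{_ : NonZero (degree x)}} → V → ℝ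
  μ α x y with y Fin.≟ x | x ∼? y
  ... | yes _ | _     = α
  ... | no  _ | yes _ = (1ℝ Real.- α) Real.* fromℚ (+ 1 ℚ./ degree x)
  ... | no  _ | no  _ = 0ℝ

  -- k is the α-Ollivier-Ricci curvature of the edge x ∼ y.
  IsOllivierRicci : ℝ → ∀ {x y} → x ∼ y → ℝ → Set
  IsOllivierRicci α {x} {y} x∼y k =
    ∃ λ w → IsW₁ (μ α x {{degree≢0 x∼y}}) (μ α y {{degree≢0 (symmetric x∼y)}}) w
          × k Real.≃ 1ℝ Real.- w

  -- κ is the limit of κ_α(x,y) / (1 - α) as α ↑ 1.
  IsLinLuYau : ∀ {x y} → x ∼ y → ℝ → Set
  IsLinLuYau x∼y κ =
    ∀ ε → 0ℝ Real.< ε →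
    ∃ λ δ → 0ℝ Real.< δ ×
      (∀ α → 0ℝ Real.≤ α → 1ℝ Real.- δ Real.< α → (α<1 : α Real.< 1ℝ) →
       ∃ λ k → IsOllivierRicci α x∼y k
             × κ Real.- ε Real.< k Real.* recip (1ℝ Real.- α) (x<y⇒0<y-x α<1)
             × k Real.* recip (1ℝ Real.- α) (x<y⇒0<y-x α<1) Real.< κ Real.+ ε)

-- Write n = 3(3 + s).  The graph is a blow-up of the 5-cycle
-- left — right — rightOnly — hub — leftOnly — left, with cliques of sizes
-- 1, 1, 3 + s, 1, 3 + s, joined completely to a clique of s common
-- neighbours of left and right.  Both left and right have the minimal degree
-- D = 4 + 2s.  No edge joins leftOnly to rightOnly, so the 3 + s exclusive
-- neighbours of left must each travel distance 2: with q = (1 - α)/D an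
-- optimal plan moves α - q along the edge and q from leftOnly to rightOnly.
-- The 1-Lipschitz potential "level" certifies optimality by complementary
-- slackness, so W₁ = (α - q) + 2(3 + s)q = 1 + q, κ_α = -q and κ = -1/D.

module Submission where

open import Defs
open import Data.Nat using (ℕ; _*_; _/_; _∸_; _≤_)
open import Data.Nat.Divisibility using (_∣_)
open import Data.Product using (Σ; ∃; _×_)
open import Relation.Binary.PropositionalEquality using (_≡_)

open import Algebra.Bundles using (CommutativeMonoid)
open import Data.Bool.Base using (Bool; true; false; T; not; _∧_; _∨_; if_then_else_)
open import Data.Bool.Properties using (T?; ∨-comm; ∨-zeroʳ)
open import Data.Fin.Base using (Fin; zero; suc; _↑ˡ_; _↑ʳ_; splitAt)
import Data.Fin.Properties as Fin
open import Data.Integer.Base as ℤ using (+_)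
import Data.Integer.Properties as ℤ
open import Data.List.Base using (length; filter; tabulate; allFin)
open import Data.List.Membership.Propositional.Properties using (∈-map⁺; ∈-allFin)
open import Data.List.Properties using (length-filter; length-tabulate)
import Data.List.Relation.Unary.All as All
import Data.List.Relation.Unary.All.Properties as All
open import Data.Nat.Base as ℕ using (zero; suc; NonZero; z≤n; s≤s)
open import Data.Nat.Coprimality using (coprime?; coprime-divisor)
open import Data.Nat.Divisibility using (divides)
open import Data.Nat.DivMod using (m*n/n≡m)
import Data.Nat.Properties as ℕ
open import Data.Nat.Solver using () renaming (module +-*-Solver to ℕ-Solver)
open import Data.Product using (_,_; proj₁; proj₂)
open import Data.Rational.Base as ℚ using (ℚ; 0ℚ; 1ℚ)
import Data.Rational.Properties as ℚ
open import Data.Rational.Solver using (module +-*-Solver)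
import Data.Rational.Unnormalised.Base as ℚᵘ
import Data.Rational.Unnormalised.Properties as ℚᵘ
open import Data.Sum.Base using (_⊎_; inj₁; inj₂; [_,_]′)
open import Level using (0ℓ)
open import Relation.Binary.Bundles using (Poset; Setoid)
open import Relation.Binary.PropositionalEquality
  using (refl; sym; trans; cong; cong₂; subst; module ≡-Reasoning)
open import Relation.Binary.Structures using (IsEquivalence)
open import Relation.Nullary.Construct.Add.Supremum using (⊤⁺; [_])
open import Relation.Nullary.Decidable using (yes; no; does; ¬?; _×-dec_; from-yes)
open import Relation.Nullary.Negation.Core using (¬_; contradiction)
import Relation.Unary as Unary
open import Data.List.Extrema ℕ.≤-totalOrder using (min≈v⁺)
open import Relation.Binary.Construct.Add.Supremum.NonStrict ℕ._≤_ using (_≤⁺_; [_])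

open Real using (ℝ; fromℚ; fromℕ; 0ℝ; 1ℝ; recip; x<y⇒0<y-x; ∑; Eventually; seq; cauchy;
                 mk≤; mk≃; mk<; eventually-≤; eventually-close;
                 gap; gap-positive; eventually-gap)
  renaming (_+_ to infixl 6 _+ᴿ_; _-_ to infixl 6 _-ᴿ_; -_ to infix 8 -ᴿ_;
            _*_ to infixl 7 _*ᴿ_; _≤_ to infix 4 _≤ᴿ_; _≃_ to infix 4 _≃ᴿ_; _<_ to infix 4 _<ᴿ_)

-- The Cauchy reals as an ordered commutative monoid

-- The size 3 + s is forced. With m exclusive neighbours on each side and s common ones, n = 3 + 2m
-- + s and `left` has degree 1 + m + s; equating this with 2n/3 - 2 gives m = 3 + s. The plan costs
-- 1 + (m - s - 2)q in general, so this is also the first m for which the cost exceeds 1. The `hub`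
-- serves two ends: it lifts the degree of `leftOnly` and `rightOnly` vertices from D - 1 to D, and
-- it keeps partners at distance 2 when s = 0, where no common neighbour is available.
--
-- Order and equality of Cauchy reals are undecidable, so no case distinction on reals is made. The
-- potential takes values in ℕ: pairings with it are natural multiples `k • x`, and duality is
-- stated with sums on both sides instead of differences, which leaves the bookkeeping to a
-- commutative monoid solver. The value -q is exact once q ≤ α, which α > 1/2 guarantees; the
-- quotient by 1 - α is then constant in α, so the limit needs no asymptotic estimate.

transfer-≤ : ∀ {a b c d} → a ℚ.≤ b → b ℚ.- a ≡ d ℚ.- c → c ℚ.≤ d
-- Only the difference of the two sides matters, so rearranging an inequality costs a single
-- identity for the ring solver.
transfer-≤ {a} {b} {c} {d} a≤b eq = begin
  c                        ≡⟨ cancel a c ⟩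
  (c ℚ.- a) ℚ.+ a          ≤⟨ ℚ.+-monoʳ-≤ (c ℚ.- a) a≤b ⟩
  (c ℚ.- a) ℚ.+ b          ≡⟨ swap a b c ⟩
  c ℚ.+ (b ℚ.- a)          ≡⟨ cong (c ℚ.+_) eq ⟩
  c ℚ.+ (d ℚ.- c)          ≡⟨ cancel′ c d ⟩
  d                        ∎
  where
  open ℚ.≤-Reasoning
  open +-*-Solver
  cancel : ∀ a c → c ≡ (c ℚ.- a) ℚ.+ a
  cancel = solve 2 (λ a c → c := (c :- a) :+ a) refl
  cancel′ : ∀ c d → c ℚ.+ (d ℚ.- c) ≡ d
  cancel′ = solve 2 (λ c d → c :+ (d :- c) := d) refl
  swap : ∀ a b c → (c ℚ.- a) ℚ.+ b ≡ c ℚ.+ (b ℚ.- a)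
  swap = solve 3 (λ a b c → (c :- a) :+ b := c :+ (b :- a)) refl

p≤∣p∣ : ∀ p → p ℚ.≤ ℚ.∣ p ∣
p≤∣p∣ p with ℚ.∣p∣≡p∨∣p∣≡-p p
... | inj₁ eq = ℚ.≤-reflexive (sym eq)
... | inj₂ eq = ℚ.≤-trans
  (transfer-≤ (subst (0ℚ ℚ.≤_) eq (ℚ.0≤∣p∣ p)) (swap p)) (ℚ.0≤∣p∣ p)
  where
  open +-*-Solver
  swap : ∀ p → (ℚ.- p) ℚ.- 0ℚ ≡ 0ℚ ℚ.- p
  swap = solve 1 (λ p → (:- p) :- con 0ℚ := con 0ℚ :- p) refl

∣p∣≤q : ∀ {p q} → p ℚ.≤ q → ℚ.- p ℚ.≤ q → ℚ.∣ p ∣ ℚ.≤ q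
∣p∣≤q {p} p≤q -p≤q with ℚ.∣p∣≡p∨∣p∣≡-p p
... | inj₁ eq = subst (ℚ._≤ _) (sym eq) p≤q
... | inj₂ eq = subst (ℚ._≤ _) (sym eq) -p≤q

-- Generic in the monoid because the same sums occur in ℝ, for masses, and in ℕ, for degrees.
module FiniteSum {c ℓ} (M : CommutativeMonoid c ℓ) where
  open CommutativeMonoid M renaming (Carrier to A; trans to trans-≈; sym to sym-≈)
  open import Algebra.Properties.CommutativeMonoid.Sum M using (sum; sum-replicate-zero)

  -- The point mass a at p. Branching on `does` lets it compute on constructors of `Fin`, even when
  -- an index below `suc` is a variable.
  only : ∀ {n} → Fin n → A → Fin n → A
  only p a i = if does (p Fin.≟ i) then a else ε

  ∑-only : ∀ {n} (p : Fin n) a → sum (only p a) ≈ a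
  ∑-only {suc n} zero    a = trans-≈ (∙-congˡ (sum-replicate-zero n)) (identityʳ a)
  ∑-only {suc n} (suc p) a = trans-≈ (identityˡ _) (∑-only p a)

  ∑-↑ : ∀ m {n} (f : Fin (m ℕ.+ n) → A) →
        sum f ≈ sum (λ i → f (i ↑ˡ n)) ∙ sum (λ j → f (m ↑ʳ j))
  ∑-↑ zero    f = sym-≈ (identityˡ _)
  ∑-↑ (suc m) f = trans-≈ (∙-congˡ (∑-↑ m (λ i → f (suc i))))
                    (sym-≈ (assoc _ _ _))

half>0 : ∀ ε .{{_ : ℚ.Positive ε}} → ℚ.Positive (ε ℚ.* ℚ.½)
half>0 ε = ℚ.pos*pos⇒pos ε ℚ.½

map-eventually : ∀ {P Q : ℕ → Set} → (∀ {n} → P n → Q n) → Eventually P → Eventually Q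
map-eventually f (N , p) = N , λ n n≥N → f (p n n≥N)

zip-eventually : ∀ {P Q R : ℕ → Set} → (∀ {n} → P n → Q n → R n) →
                 Eventually P → Eventually Q → Eventually R
zip-eventually f (M , p) (N , q) = M ℕ.⊔ N , λ n n≥ →
  f (p n (ℕ.m⊔n≤o⇒m≤o M N n≥)) (q n (ℕ.m⊔n≤o⇒n≤o M N n≥))

eventually-≤⇒≤ᴿ : ∀ {x y} → Eventually (λ n → seq x n ℚ.≤ seq y n) → x ≤ᴿ y
eventually-≤⇒≤ᴿ {x} {y} h = mk≤ λ ε → map-eventually
  (λ {n} x≤y → ℚ.≤-trans (ℚ.≤-reflexive (sym (ℚ.+-identityʳ (seq x n))))
                 (ℚ.+-mono-≤ x≤y (ℚ.<⇒≤ (ℚ.positive⁻¹ ε)))) h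

≤ᴿ-refl : ∀ {x} → x ≤ᴿ x
≤ᴿ-refl = eventually-≤⇒≤ᴿ (0 , λ _ _ → ℚ.≤-refl)

≤ᴿ-trans : ∀ {x y z} → x ≤ᴿ y → y ≤ᴿ z → x ≤ᴿ z
≤ᴿ-trans {x} {y} {z} x≤y y≤z = mk≤ λ ε → zip-eventually
  (λ {n} p q → transfer-≤ (ℚ.+-mono-≤ p q) (rearrange (seq x n) (seq y n) (seq z n) ε))
  (eventually-≤ x≤y (ε ℚ.* ℚ.½) {{half>0 ε}}) (eventually-≤ y≤z (ε ℚ.* ℚ.½) {{half>0 ε}})
  where
  open +-*-Solver
  rearrange : ∀ a b c e →
    ((b ℚ.+ e ℚ.* ℚ.½) ℚ.+ (c ℚ.+ e ℚ.* ℚ.½)) ℚ.- (a ℚ.+ b) ≡ (c ℚ.+ e) ℚ.- a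
  rearrange = solve 4 (λ a b c e →
    ((b :+ e :* con ℚ.½) :+ (c :+ e :* con ℚ.½)) :- (a :+ b) := (c :+ e) :- a) refl

≃ᴿ⇒≤ᴿ : ∀ {x y} → x ≃ᴿ y → x ≤ᴿ y
≃ᴿ⇒≤ᴿ {x} {y} x≃y = mk≤ λ ε → map-eventually
  (λ {n} h → transfer-≤ (ℚ.≤-trans (p≤∣p∣ (seq x n ℚ.- seq y n)) h)
               (rearrange (seq x n) (seq y n) ε))
  (eventually-close x≃y ε)
  where
  open +-*-Solver
  rearrange : ∀ a b e → e ℚ.- (a ℚ.- b) ≡ (b ℚ.+ e) ℚ.- a
  rearrange = solve 3 (λ a b e → e :- (a :- b) := (b :+ e) :- a) refl

≤ᴿ-antisym : ∀ {x y} → x ≤ᴿ y → y ≤ᴿ x → x ≃ᴿ y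
≤ᴿ-antisym {x} {y} x≤y y≤x = mk≃ λ ε → zip-eventually
  (λ {n} p q → ∣p∣≤q (transfer-≤ p (left (seq x n) (seq y n) ε))
                     (transfer-≤ q (right (seq x n) (seq y n) ε)))
  (eventually-≤ x≤y ε) (eventually-≤ y≤x ε)
  where
  open +-*-Solver
  left : ∀ a b e → (b ℚ.+ e) ℚ.- a ≡ e ℚ.- (a ℚ.- b)
  left = solve 3 (λ a b e → (b :+ e) :- a := e :- (a :- b)) refl
  right : ∀ a b e → (a ℚ.+ e) ℚ.- b ≡ e ℚ.- (ℚ.- (a ℚ.- b))
  right = solve 3 (λ a b e → (a :+ e) :- b := e :- (:- (a :- b))) refl

≃ᴿ-sym : ∀ {x y} → x ≃ᴿ y → y ≃ᴿ x
≃ᴿ-sym {x} {y} x≃y = mk≃ λ ε → map-eventually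
  (λ {n} → subst (ℚ._≤ ε) (trans (sym (ℚ.∣-p∣≡∣p∣ (seq x n ℚ.- seq y n)))
                                 (cong ℚ.∣_∣ (flip (seq x n) (seq y n)))))
  (eventually-close x≃y ε)
  where
  open +-*-Solver
  flip : ∀ a b → ℚ.- (a ℚ.- b) ≡ b ℚ.- a
  flip = solve 2 (λ a b → :- (a :- b) := b :- a) refl

≗⇒≃ᴿ : ∀ {x y} → (∀ n → seq x n ≡ seq y n) → x ≃ᴿ y
≗⇒≃ᴿ h = ≤ᴿ-antisym (eventually-≤⇒≤ᴿ (0 , λ n _ → ℚ.≤-reflexive (h n)))
                    (eventually-≤⇒≤ᴿ (0 , λ n _ → ℚ.≤-reflexive (sym (h n))))

≃ᴿ-refl : ∀ {x} → x ≃ᴿ x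
≃ᴿ-refl = ≗⇒≃ᴿ λ _ → refl

≃ᴿ-trans : ∀ {x y z} → x ≃ᴿ y → y ≃ᴿ z → x ≃ᴿ z
≃ᴿ-trans p q = ≤ᴿ-antisym (≤ᴿ-trans (≃ᴿ⇒≤ᴿ p) (≃ᴿ⇒≤ᴿ q))
                          (≤ᴿ-trans (≃ᴿ⇒≤ᴿ (≃ᴿ-sym q)) (≃ᴿ⇒≤ᴿ (≃ᴿ-sym p)))

≡⇒≃ᴿ : ∀ {x y} → x ≡ y → x ≃ᴿ y
≡⇒≃ᴿ refl = ≃ᴿ-refl

≃ᴿ-isEquivalence : IsEquivalence _≃ᴿ_
≃ᴿ-isEquivalence = record { refl = ≃ᴿ-refl ; sym = ≃ᴿ-sym ; trans = ≃ᴿ-trans }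

≃ᴿ-setoid : Setoid 0ℓ 0ℓ
≃ᴿ-setoid = record { isEquivalence = ≃ᴿ-isEquivalence }

≤ᴿ-poset : Poset 0ℓ 0ℓ 0ℓ
≤ᴿ-poset = record
  { isPartialOrder = record
    { isPreorder = record
      { isEquivalence = ≃ᴿ-isEquivalence
      ; reflexive     = ≃ᴿ⇒≤ᴿ
      ; trans         = ≤ᴿ-trans
      }
    ; antisym = ≤ᴿ-antisym
    }
  }

import Relation.Binary.Reasoning.PartialOrder ≤ᴿ-poset as ≤ᴿ-Reasoning
import Relation.Binary.Reasoning.Setoid ≃ᴿ-setoid as ≃ᴿ-Reasoning

+ᴿ-mono-≤ : ∀ {x y u v} → x ≤ᴿ y → u ≤ᴿ v → x +ᴿ u ≤ᴿ y +ᴿ v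
+ᴿ-mono-≤ {x} {y} {u} {v} x≤y u≤v = mk≤ λ ε → zip-eventually
  (λ {n} p q → transfer-≤ (ℚ.+-mono-≤ p q)
     (rearrange (seq x n) (seq y n) (seq u n) (seq v n) ε))
  (eventually-≤ x≤y (ε ℚ.* ℚ.½) {{half>0 ε}}) (eventually-≤ u≤v (ε ℚ.* ℚ.½) {{half>0 ε}})
  where
  open +-*-Solver
  rearrange : ∀ a b c d e →
    ((b ℚ.+ e ℚ.* ℚ.½) ℚ.+ (d ℚ.+ e ℚ.* ℚ.½)) ℚ.- (a ℚ.+ c) ≡ ((b ℚ.+ d) ℚ.+ e) ℚ.- (a ℚ.+ c)
  rearrange = solve 5 (λ a b c d e →
    ((b :+ e :* con ℚ.½) :+ (d :+ e :* con ℚ.½)) :- (a :+ c) := ((b :+ d) :+ e) :- (a :+ c)) refl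

-- The library's `sum` over this monoid unfolds to the same fold as `∑`, so its lemmas apply to
-- marginals and costs directly.
+ᴿ-commutativeMonoid : CommutativeMonoid 0ℓ 0ℓ
+ᴿ-commutativeMonoid = record
  { Carrier = ℝ
  ; _≈_     = _≃ᴿ_
  ; _∙_     = _+ᴿ_
  ; ε       = 0ℝ
  ; isCommutativeMonoid = record
    { isMonoid = record
      { isSemigroup = record
        { isMagma = record
          { isEquivalence = ≃ᴿ-isEquivalence
          ; ∙-cong = λ p q → ≤ᴿ-antisym (+ᴿ-mono-≤ (≃ᴿ⇒≤ᴿ p) (≃ᴿ⇒≤ᴿ q))
                       (+ᴿ-mono-≤ (≃ᴿ⇒≤ᴿ (≃ᴿ-sym p)) (≃ᴿ⇒≤ᴿ (≃ᴿ-sym q)))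
          }
        ; assoc = λ x y z → ≗⇒≃ᴿ λ n → ℚ.+-assoc (seq x n) (seq y n) (seq z n)
        }
      ; identity = (λ x → ≗⇒≃ᴿ λ n → ℚ.+-identityˡ (seq x n))
                 , (λ x → ≗⇒≃ᴿ λ n → ℚ.+-identityʳ (seq x n))
      }
    ; comm = λ x y → ≗⇒≃ᴿ λ n → ℚ.+-comm (seq x n) (seq y n)
    }
  }

open CommutativeMonoid +ᴿ-commutativeMonoid using ()
  renaming (∙-cong to +ᴿ-cong; ∙-congˡ to +ᴿ-congˡ; ∙-congʳ to +ᴿ-congʳ;
            identityˡ to +ᴿ-identityˡ; identityʳ to +ᴿ-identityʳ; comm to +ᴿ-comm)
open import Algebra.Properties.CommutativeMonoid.Sum +ᴿ-commutativeMonoid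
  using (sum-cong-≋; sum-replicate; sum-replicate-zero; ∑-distrib-+; ∑-comm)
open import Algebra.Properties.CommutativeMonoid.Mult +ᴿ-commutativeMonoid
  using (×-congʳ; ×-homo-+; ×-distrib-+)
  renaming (_×_ to infixr 8 _•_)

x≤y+x : ∀ {x y} → 0ℝ ≤ᴿ y → x ≤ᴿ y +ᴿ x
x≤y+x {x} {y} 0≤y = begin
  x          ≈⟨ +ᴿ-identityˡ x ⟨
  0ℝ +ᴿ x    ≤⟨ +ᴿ-mono-≤ 0≤y ≤ᴿ-refl ⟩
  y +ᴿ x     ∎
  where open ≤ᴿ-Reasoning

+ᴿ-nonneg : ∀ {x y} → 0ℝ ≤ᴿ x → 0ℝ ≤ᴿ y → 0ℝ ≤ᴿ x +ᴿ y
+ᴿ-nonneg 0≤x 0≤y = ≤ᴿ-trans 0≤y (x≤y+x 0≤x)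

•-mono-≤ : ∀ {k l x} → 0ℝ ≤ᴿ x → k ≤ l → k • x ≤ᴿ l • x
•-mono-≤ {l = zero}  0≤x z≤n       = ≤ᴿ-refl
•-mono-≤ {l = suc l} 0≤x z≤n       = ≤ᴿ-trans (•-mono-≤ {l = l} 0≤x z≤n) (x≤y+x 0≤x)
•-mono-≤             0≤x (s≤s k≤l) = +ᴿ-mono-≤ ≤ᴿ-refl (•-mono-≤ 0≤x k≤l)

∑-mono-≤ : ∀ {n} {f g : Fin n → ℝ} → (∀ i → f i ≤ᴿ g i) → ∑ f ≤ᴿ ∑ g
∑-mono-≤ {zero}  f≤g = ≤ᴿ-refl
∑-mono-≤ {suc n} f≤g = +ᴿ-mono-≤ (f≤g zero) (∑-mono-≤ λ i → f≤g (suc i))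

•-zero : ∀ k → k • 0ℝ ≃ᴿ 0ℝ
•-zero zero    = ≃ᴿ-refl
•-zero (suc k) = ≃ᴿ-trans (+ᴿ-identityˡ _) (•-zero k)

•-distrib-∑ : ∀ k {n} (f : Fin n → ℝ) → ∑ (λ i → k • f i) ≃ᴿ k • ∑ f
•-distrib-∑ k {zero}  f = ≃ᴿ-sym (•-zero k)
•-distrib-∑ k {suc n} f = ≃ᴿ-trans (+ᴿ-congˡ (•-distrib-∑ k (λ i → f (suc i))))
                                   (≃ᴿ-sym (×-distrib-+ (f zero) (∑ (λ i → f (suc i))) k))

-- Natural multiples as rational scalars

/-homo-+ : ∀ p q → ℚ.fromℚᵘ (p ℚᵘ.+ q) ≡ ℚ.fromℚᵘ p ℚ.+ ℚ.fromℚᵘ q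
/-homo-+ p q = ℚ.toℚᵘ-injective (begin
  ℚ.toℚᵘ (ℚ.fromℚᵘ (p ℚᵘ.+ q))                      ≈⟨ ℚ.toℚᵘ-fromℚᵘ (p ℚᵘ.+ q) ⟩
  p ℚᵘ.+ q                                          ≈⟨ ℚᵘ.+-cong (ℚ.toℚᵘ-fromℚᵘ p) (ℚ.toℚᵘ-fromℚᵘ q) ⟨
  ℚ.toℚᵘ (ℚ.fromℚᵘ p) ℚᵘ.+ ℚ.toℚᵘ (ℚ.fromℚᵘ q)      ≈⟨ ℚ.toℚᵘ-homo-+ (ℚ.fromℚᵘ p) (ℚ.fromℚᵘ q) ⟨
  ℚ.toℚᵘ (ℚ.fromℚᵘ p ℚ.+ ℚ.fromℚᵘ q)                ∎)
  where open import Relation.Binary.Reasoning.Setoid ℚᵘ.≃-setoid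

/-homo-* : ∀ p q → ℚ.fromℚᵘ (p ℚᵘ.* q) ≡ ℚ.fromℚᵘ p ℚ.* ℚ.fromℚᵘ q
/-homo-* p q = ℚ.toℚᵘ-injective (begin
  ℚ.toℚᵘ (ℚ.fromℚᵘ (p ℚᵘ.* q))                      ≈⟨ ℚ.toℚᵘ-fromℚᵘ (p ℚᵘ.* q) ⟩
  p ℚᵘ.* q                                          ≈⟨ ℚᵘ.*-cong (ℚ.toℚᵘ-fromℚᵘ p) (ℚ.toℚᵘ-fromℚᵘ q) ⟨
  ℚ.toℚᵘ (ℚ.fromℚᵘ p) ℚᵘ.* ℚ.toℚᵘ (ℚ.fromℚᵘ q)      ≈⟨ ℚ.toℚᵘ-homo-* (ℚ.fromℚᵘ p) (ℚ.fromℚᵘ q) ⟨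
  ℚ.toℚᵘ (ℚ.fromℚᵘ p ℚ.* ℚ.fromℚᵘ q)                ∎)
  where open import Relation.Binary.Reasoning.Setoid ℚᵘ.≃-setoid

suc/1 : ∀ k → + suc k ℚ./ 1 ≡ 1ℚ ℚ.+ (+ k ℚ./ 1)
suc/1 k = trans
  -- Unnormalised rationals sidestep the gcd in `ℚ./`, which is stuck on the variable k.
  (ℚ.fromℚᵘ-cong {ℚᵘ.mkℚᵘ (+ suc k) 0} {ℚᵘ.1ℚᵘ ℚᵘ.+ ℚᵘ.mkℚᵘ (+ k) 0}
    (ℚᵘ.*≡* (cong (λ i → (+ 1 ℤ.+ i) ℤ.* + 1) (sym (ℤ.*-identityʳ (+ k))))))
  (/-homo-+ ℚᵘ.1ℚᵘ (ℚᵘ.mkℚᵘ (+ k) 0))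

1/k*k : ∀ k .{{_ : NonZero k}} → (+ 1 ℚ./ k) ℚ.* (+ k ℚ./ 1) ≡ 1ℚ
1/k*k (suc k) = trans
  (sym (/-homo-* (ℚᵘ.mkℚᵘ (+ 1) k) (ℚᵘ.mkℚᵘ (+ suc k) 0)))
  (ℚ.fromℚᵘ-cong {ℚᵘ.mkℚᵘ (+ 1) k ℚᵘ.* ℚᵘ.mkℚᵘ (+ suc k) 0} {ℚᵘ.1ℚᵘ}
    (ℚᵘ.*≡* (trans (ℤ.*-identityʳ _) (trans (ℤ.*-identityˡ (+ suc k))
      (trans (cong +_ (sym (ℕ.*-identityʳ (suc k)))) (sym (ℤ.*-identityˡ _)))))))

seq-• : ∀ k x n → seq (k • x) n ≡ (+ k ℚ./ 1) ℚ.* seq x n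
seq-• zero    x n = sym (ℚ.*-zeroˡ (seq x n))
seq-• (suc k) x n = begin
  seq x n ℚ.+ seq (k • x) n                          ≡⟨ cong (seq x n ℚ.+_) (seq-• k x n) ⟩
  seq x n ℚ.+ (+ k ℚ./ 1) ℚ.* seq x n                ≡⟨ collect (seq x n) (+ k ℚ./ 1) ⟩
  (1ℚ ℚ.+ (+ k ℚ./ 1)) ℚ.* seq x n                   ≡⟨ cong (ℚ._* seq x n) (suc/1 k) ⟨
  (+ suc k ℚ./ 1) ℚ.* seq x n                        ∎
  where
  open ≡-Reasoning
  open +-*-Solver
  collect : ∀ a b → a ℚ.+ b ℚ.* a ≡ (1ℚ ℚ.+ b) ℚ.* a
  collect = solve 2 (λ a b → a :+ b :* a := (con 1ℚ :+ b) :* a) refl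

-- Translates the product in the definition of `cost` into the natural multiples used for duality.
fromℕ-* : ∀ k x → fromℕ k *ᴿ x ≃ᴿ k • x
fromℕ-* k x = ≗⇒≃ᴿ λ n → sym (seq-• k x n)

•-fraction : ∀ k .{{_ : NonZero k}} x → k • (x *ᴿ fromℚ (+ 1 ℚ./ k)) ≃ᴿ x
•-fraction k x = ≗⇒≃ᴿ λ n → begin
  seq (k • (x *ᴿ fromℚ (+ 1 ℚ./ k))) n               ≡⟨ seq-• k _ n ⟩
  (+ k ℚ./ 1) ℚ.* (seq x n ℚ.* (+ 1 ℚ./ k))          ≡⟨ rearrange (+ k ℚ./ 1) (seq x n) (+ 1 ℚ./ k) ⟩
  seq x n ℚ.* ((+ 1 ℚ./ k) ℚ.* (+ k ℚ./ 1))          ≡⟨ cong (seq x n ℚ.*_) (1/k*k k) ⟩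
  seq x n ℚ.* 1ℚ                                     ≡⟨ ℚ.*-identityʳ (seq x n) ⟩
  seq x n                                            ∎
  where
  open ≡-Reasoning
  open +-*-Solver
  rearrange : ∀ a b c → a ℚ.* (b ℚ.* c) ≡ b ℚ.* (c ℚ.* a)
  rearrange = solve 3 (λ a b c → a :* (b :* c) := b :* (c :* a)) refl

open FiniteSum +ᴿ-commutativeMonoid using (only; ∑-only)

-- Scaling, reciprocals and strict inequalities

fromℚ-*-cong : ∀ r {x y} → x ≃ᴿ y → fromℚ r *ᴿ x ≃ᴿ fromℚ r *ᴿ y
fromℚ-*-cong r {x} {y} x≃y = mk≃ λ ε → map-eventually
  (λ {n} → scale ε (seq x n) (seq y n)) (eventually-close x≃y (ε ℚ.* i) {{ℚ.pos*pos⇒pos ε i}})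
  where
  open ℚ.≤-Reasoning
  open +-*-Solver
  instance
    b>0 : ℚ.Positive (1ℚ ℚ.+ ℚ.∣ r ∣)
    b>0 = ℚ.pos+nonNeg⇒pos 1ℚ ℚ.∣ r ∣ {{ℚ.∣-∣-nonNeg r}}
    b≢0 : ℚ.NonZero (1ℚ ℚ.+ ℚ.∣ r ∣)
    b≢0 = ℚ.pos⇒nonZero (1ℚ ℚ.+ ℚ.∣ r ∣)
  b i : ℚ
  -- The added 1 keeps the divisor positive when r = 0.
  b = 1ℚ ℚ.+ ℚ.∣ r ∣
  i = ℚ.1/ b
  instance
    i>0 : ℚ.Positive i
    i>0 = ℚ.1/pos⇒pos b
  factor : ∀ r a c → r ℚ.* a ℚ.- r ℚ.* c ≡ r ℚ.* (a ℚ.- c)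
  factor = solve 3 (λ r a c → r :* a :- r :* c := r :* (a :- c)) refl
  rotate : ∀ b e i → b ℚ.* (e ℚ.* i) ≡ e ℚ.* (b ℚ.* i)
  rotate = solve 3 (λ b e i → b :* (e :* i) := e :* (b :* i)) refl
  scale : ∀ ε .{{_ : ℚ.Positive ε}} a c → ℚ.∣ a ℚ.- c ∣ ℚ.≤ ε ℚ.* i → ℚ.∣ r ℚ.* a ℚ.- r ℚ.* c ∣ ℚ.≤ ε
  scale ε a c h = begin
    ℚ.∣ r ℚ.* a ℚ.- r ℚ.* c ∣      ≡⟨ cong ℚ.∣_∣ (factor r a c) ⟩
    ℚ.∣ r ℚ.* (a ℚ.- c) ∣          ≡⟨ ℚ.∣p*q∣≡∣p∣*∣q∣ r (a ℚ.- c) ⟩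
    ℚ.∣ r ∣ ℚ.* ℚ.∣ a ℚ.- c ∣      ≤⟨ ℚ.*-monoˡ-≤-nonNeg ℚ.∣ r ∣ {{ℚ.∣-∣-nonNeg r}} h ⟩
    ℚ.∣ r ∣ ℚ.* (ε ℚ.* i)          ≤⟨ ℚ.*-monoʳ-≤-nonNeg (ε ℚ.* i)
                                        {{ℚ.pos⇒nonNeg (ε ℚ.* i) {{ℚ.pos*pos⇒pos ε i}}}}
                                        (ℚ.≤-trans (ℚ.≤-reflexive (sym (ℚ.+-identityˡ ℚ.∣ r ∣)))
                                          (ℚ.+-monoˡ-≤ ℚ.∣ r ∣ (ℚ.<⇒≤ (ℚ.positive⁻¹ 1ℚ)))) ⟩
    b ℚ.* (ε ℚ.* i)                ≡⟨ rotate b ε i ⟩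
    ε ℚ.* (b ℚ.* i)                ≡⟨ cong (ε ℚ.*_) (ℚ.*-inverseʳ b) ⟩
    ε ℚ.* 1ℚ                       ≡⟨ ℚ.*-identityʳ ε ⟩
    ε                              ∎

-- `recip` inverts a shifted sequence t, so the product is not termwise 1. The error is (x_n -
-- t_n)/t_n, with |x_n - t_n| at most εg by the Cauchy property and 1/t_n at most 1/g.
*ᴿ-inverseʳ : ∀ x (0<x : 0ℝ <ᴿ x) → x *ᴿ recip x 0<x ≃ᴿ 1ℝ
*ᴿ-inverseʳ x 0<x = mk≃ close
  where
  open Real.Reciprocal x 0<x
  open ℚ.≤-Reasoning
  open +-*-Solver
  g : ℚ
  g = gap 0<x
  factor : ∀ a c d → a ℚ.* d ℚ.- c ℚ.* d ≡ (a ℚ.- c) ℚ.* d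
  factor = solve 3 (λ a c d → a :* d :- c :* d := (a :- c) :* d) refl
  close : ∀ ε .{{_ : ℚ.Positive ε}} →
          Eventually λ n → ℚ.∣ seq x n ℚ.* 1/t n ℚ.- 1ℚ ∣ ℚ.≤ ε
  close ε with cauchy x (ε ℚ.* g) {{ℚ.pos*pos⇒pos ε g {{gap-positive 0<x}}}}
  ... | M , X = M , λ n n≥M → begin
    ℚ.∣ seq x n ℚ.* 1/t n ℚ.- 1ℚ ∣
      ≡⟨ cong (λ z → ℚ.∣ seq x n ℚ.* 1/t n ℚ.- z ∣) (ℚ.*-inverseʳ (t n) {{t≢0 n}}) ⟨
    ℚ.∣ seq x n ℚ.* 1/t n ℚ.- t n ℚ.* 1/t n ∣
      ≡⟨ cong ℚ.∣_∣ (factor (seq x n) (t n) (1/t n)) ⟩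
    ℚ.∣ (seq x n ℚ.- t n) ℚ.* 1/t n ∣
      ≡⟨ ℚ.∣p*q∣≡∣p∣*∣q∣ (seq x n ℚ.- t n) (1/t n) ⟩
    ℚ.∣ seq x n ℚ.- t n ∣ ℚ.* ℚ.∣ 1/t n ∣
      ≡⟨ cong (ℚ.∣ seq x n ℚ.- t n ∣ ℚ.*_) (ℚ.0≤p⇒∣p∣≡p (ℚ.nonNegative⁻¹ (1/t n) {{1/t≥0 n}})) ⟩
    ℚ.∣ seq x n ℚ.- t n ∣ ℚ.* 1/t n
      ≤⟨ ℚ.*-monoʳ-≤-nonNeg (1/t n) {{1/t≥0 n}} (X n _ n≥M (ℕ.m≤n⇒m≤o+n _ n≥M)) ⟩
    (ε ℚ.* g) ℚ.* 1/t n
      ≡⟨ ℚ.*-assoc ε g (1/t n) ⟩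
    ε ℚ.* (g ℚ.* 1/t n)
      ≤⟨ ℚ.*-monoˡ-≤-nonNeg ε {{ℚ.pos⇒nonNeg ε}} (q/t≤1 n) ⟩
    ε ℚ.* 1ℚ
      ≡⟨ ℚ.*-identityʳ ε ⟩
    ε ∎

-- Half of the gap of ε absorbs the tolerance in x ≃ y; the other half remains as the gap of the
-- conclusion.
≃ᴿ⇒-ε< : ∀ {x y ε} → x ≃ᴿ y → 0ℝ <ᴿ ε → x -ᴿ ε <ᴿ y
≃ᴿ⇒-ε< {x} {y} {ε} x≃y (mk< g g>0 g≤ε) = mk< (g ℚ.* ℚ.½) (half>0 g {{g>0}}) (zip-eventually
  (λ {n} p q → transfer-≤ (ℚ.+-mono-≤ p q) (rearrange (seq x n) (seq y n) (seq ε n) g))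
  g≤ε (eventually-≤ (≃ᴿ⇒≤ᴿ x≃y) (g ℚ.* ℚ.½) {{half>0 g {{g>0}}}}))
  where
  open +-*-Solver
  rearrange : ∀ a b e g → ((e ℚ.- 0ℚ) ℚ.+ (b ℚ.+ g ℚ.* ℚ.½)) ℚ.- (g ℚ.+ a)
                        ≡ (b ℚ.- (a ℚ.- e)) ℚ.- g ℚ.* ℚ.½
  rearrange = solve 4 (λ a b e g → ((e :- con 0ℚ) :+ (b :+ g :* con ℚ.½)) :- (g :+ a)
                        := (b :- (a :- e)) :- g :* con ℚ.½) refl

≃ᴿ⇒<+ε : ∀ {x y ε} → x ≃ᴿ y → 0ℝ <ᴿ ε → x <ᴿ y +ᴿ ε
≃ᴿ⇒<+ε {x} {y} {ε} x≃y (mk< g g>0 g≤ε) = mk< (g ℚ.* ℚ.½) (half>0 g {{g>0}}) (zip-eventually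
  (λ {n} p q → transfer-≤ (ℚ.+-mono-≤ p q) (rearrange (seq x n) (seq y n) (seq ε n) g))
  g≤ε (eventually-≤ (≃ᴿ⇒≤ᴿ x≃y) (g ℚ.* ℚ.½) {{half>0 g {{g>0}}}}))
  where
  open +-*-Solver
  rearrange : ∀ a b e g → ((e ℚ.- 0ℚ) ℚ.+ (b ℚ.+ g ℚ.* ℚ.½)) ℚ.- (g ℚ.+ a)
                        ≡ ((b ℚ.+ e) ℚ.- a) ℚ.- g ℚ.* ℚ.½
  rearrange = solve 4 (λ a b e g → ((e :- con 0ℚ) :+ (b :+ g :* con ℚ.½)) :- (g :+ a)
                        := ((b :+ e) :- a) :- g :* con ℚ.½) refl

<ᴿ⇒≤ᴿ : ∀ {x y} → x <ᴿ y → x ≤ᴿ y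
<ᴿ⇒≤ᴿ {x} {y} (mk< g g>0 h) = eventually-≤⇒≤ᴿ (map-eventually
  (λ {n} p → transfer-≤ (ℚ.≤-trans (ℚ.<⇒≤ (ℚ.positive⁻¹ g {{g>0}})) p) (rearrange (seq x n) (seq y n))) h)
  where
  open +-*-Solver
  rearrange : ∀ a b → (b ℚ.- a) ℚ.- 0ℚ ≡ b ℚ.- a
  rearrange = solve 2 (λ a b → (b :- a) :- con 0ℚ := b :- a) refl

only-nonneg : ∀ {n} (p : Fin n) {a} → 0ℝ ≤ᴿ a → ∀ i → 0ℝ ≤ᴿ only p a i
only-nonneg p 0≤a i with does (p Fin.≟ i)
... | true  = 0≤a
... | false = ≤ᴿ-refl

only-≤ : ∀ {n} (p : Fin n) {a} → 0ℝ ≤ᴿ a → ∀ i → only p a i ≤ᴿ a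
only-≤ p 0≤a i with does (p Fin.≟ i)
... | true  = ≤ᴿ-refl
... | false = 0≤a

-- Kantorovich duality

module Duality {n} (G : SimpleGraph n) (f : Fin n → ℕ) where
  open SimpleGraph G

  ∑∑-fst : ∀ {μ₁ μ₂} (c : Coupling G μ₁ μ₂) →
           ∑ (λ u → ∑ λ v → f u • Coupling.π c u v) ≃ᴿ ∑ (λ u → f u • μ₁ u)
  ∑∑-fst c = sum-cong-≋ λ u → ≃ᴿ-trans (•-distrib-∑ (f u) (Coupling.π c u))
                                       (×-congʳ (f u) (Coupling.marginal₁ c u))

  ∑∑-snd : ∀ {μ₁ μ₂} (c : Coupling G μ₁ μ₂) →
           ∑ (λ u → ∑ λ v → f v • Coupling.π c u v) ≃ᴿ ∑ (λ v → f v • μ₂ v)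
  ∑∑-snd c = ≃ᴿ-trans (∑-comm λ u v → f v • Coupling.π c u v)
    (sum-cong-≋ λ v → ≃ᴿ-trans (•-distrib-∑ (f v) λ u → Coupling.π c u v)
                               (×-congʳ (f v) (Coupling.marginal₂ c v)))

  -- Adding the second pairing to the cost puts d(u,v) + f v next to f u under one double sum, so
  -- that the two can be compared term by term without subtraction.
  cost+∑∑ : ∀ {μ₁ μ₂} (c : Coupling G μ₁ μ₂) →
    ∑ (λ u → ∑ λ v → _·_ G (distance G u v) (Coupling.π c u v) +ᴿ f v • Coupling.π c u v)
      ≃ᴿ cost G c +ᴿ ∑ (λ v → f v • μ₂ v)
  cost+∑∑ c = ≃ᴿ-trans (sum-cong-≋ λ u → ∑-distrib-+ (transport u) (moment u))
    (≃ᴿ-trans (∑-distrib-+ (λ u → ∑ (transport u)) (λ u → ∑ (moment u)))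
              (+ᴿ-congˡ (∑∑-snd c)))
    where
    transport moment : V → V → ℝ
    transport u v = _·_ G (distance G u v) (Coupling.π c u v)
    moment u v    = f v • Coupling.π c u v

  -- The equality case of the Lipschitz bound. The walk gives distance at most k and the drop of f
  -- gives at least k, so tightness is checked without evaluating `distance`.
  Tight : V → V → Set
  Tight u v = ∃ λ k → Walk k u v × f u ≡ k ℕ.+ f v

  module _ (lipschitz : ∀ {u v} → u ∼ v → f u ≤ suc (f v)) where

    walk-lipschitz : ∀ k {u v} → Walk k u v → f u ≤ k ℕ.+ f v
    walk-lipschitz zero    refl          = ℕ.≤-refl
    walk-lipschitz (suc k) (_ , u∼w , w) = ℕ.≤-trans (lipschitz u∼w) (s≤s (walk-lipschitz k w))

    ∸≤distance : ∀ u v → [ f u ∸ f v ] ≤⁺ distance G u v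
    ∸≤distance u v = proj₂ (distance-isInfimum G u v) [ f u ∸ f v ] λ k w →
      [ ℕ.m≤n+o⇒m∸n≤o (f u) (f v) (subst (f u ≤_) (ℕ.+-comm k (f v)) (walk-lipschitz k w)) ]

    -- Weight f u ≤ d(u,v) + f v by π(u,v) ≥ 0 and sum; the marginals turn the sums of f into
    -- pairings with μ₁ and μ₂.
    weak-duality : ∀ {μ₁ μ₂} (c : Coupling G μ₁ μ₂) → FiniteCost G c →
      ∑ (λ u → f u • μ₁ u) ≤ᴿ cost G c +ᴿ ∑ (λ v → f v • μ₂ v)
    weak-duality {μ₁} {μ₂} c finite = begin
      ∑ (λ u → f u • μ₁ u)                     ≈⟨ ∑∑-fst c ⟨
      ∑ (λ u → ∑ λ v → f u • Coupling.π c u v) ≤⟨ ∑-mono-≤ (λ u → ∑-mono-≤ (pointwise u)) ⟩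
      _                                        ≈⟨ cost+∑∑ c ⟩
      cost G c +ᴿ ∑ (λ v → f v • μ₂ v)         ∎
      where
      open ≤ᴿ-Reasoning
      pointwise : ∀ u v → f u • Coupling.π c u v ≤ᴿ
                  _·_ G (distance G u v) (Coupling.π c u v) +ᴿ f v • Coupling.π c u v
      pointwise u v with distance G u v in eq | ∸≤distance u v
      -- At infinite distance the Lipschitz bound says nothing, but finiteness of the cost makes the
      -- mass vanish.
      ... | ⊤⁺    | _ = begin
        f u • Coupling.π c u v            ≈⟨ ×-congʳ (f u) (finite u v eq) ⟩
        f u • 0ℝ                          ≈⟨ •-zero (f u) ⟩
        0ℝ                                ≈⟨ •-zero (f v) ⟨
        f v • 0ℝ                          ≈⟨ ×-congʳ (f v) (finite u v eq) ⟨
        f v • Coupling.π c u v            ≈⟨ +ᴿ-identityˡ _ ⟨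
        0ℝ +ᴿ f v • Coupling.π c u v      ∎
      ... | [ d ] | [ fu∸fv≤d ] = begin
        f u • Coupling.π c u v                            ≤⟨ •-mono-≤ (Coupling.π≥0 c u v)
                                                               (subst (f u ≤_) (ℕ.+-comm (f v) d)
                                                                 (ℕ.≤-trans (ℕ.m≤n+m∸n (f u) (f v)) (ℕ.+-monoʳ-≤ (f v) fu∸fv≤d))) ⟩
        (d ℕ.+ f v) • Coupling.π c u v                    ≈⟨ ×-homo-+ (Coupling.π c u v) d (f v) ⟩
        d • Coupling.π c u v +ᴿ f v • Coupling.π c u v    ≈⟨ +ᴿ-congʳ (fromℕ-* d _) ⟨
        fromℕ d *ᴿ Coupling.π c u v +ᴿ f v • Coupling.π c u v ∎

    tight⇒distance : ∀ {u v} → ((k , _) : Tight u v) → distance G u v ≡ [ k ]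
    tight⇒distance {u} {v} (k , w , fu≡k+fv)
      with distance G u v | proj₁ (distance-isInfimum G u v) k w | ∸≤distance u v
    ... | [ d ] | [ d≤k ] | [ fu∸fv≤d ] = cong [_] (ℕ.≤-antisym d≤k
      (subst (_≤ d) (trans (cong (_∸ f v) fu≡k+fv) (ℕ.m+n∸n≡m k (f v))) fu∸fv≤d))

    module _ {μ₁ μ₂} (c : Coupling G μ₁ μ₂)
             (slack : ∀ u v → Coupling.π c u v ≃ᴿ 0ℝ ⊎ Tight u v) where

      slackness⇒finite : FiniteCost G c
      slackness⇒finite u v d≡⊤ with slack u v
      ... | inj₁ π≃0   = π≃0
      ... | inj₂ tight with trans (sym d≡⊤) (tight⇒distance tight)
      ...   | ()

      -- Complementary slackness: each term of weak duality becomes an equality, because either the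
      -- mass is zero or f drops by exactly the distance.
      strong-duality : cost G c +ᴿ ∑ (λ v → f v • μ₂ v) ≃ᴿ ∑ (λ u → f u • μ₁ u)
      strong-duality = ≃ᴿ-trans (≃ᴿ-sym (cost+∑∑ c))
        (≃ᴿ-trans (sum-cong-≋ λ u → sum-cong-≋ (pointwise u)) (∑∑-fst c))
        where
        open ≃ᴿ-Reasoning
        0· : ∀ d {p} → p ≃ᴿ 0ℝ → _·_ G d p ≃ᴿ 0ℝ
        0· ⊤⁺    p≃0 = ≃ᴿ-refl
        0· [ d ] p≃0 = ≃ᴿ-trans (fromℕ-* d _) (≃ᴿ-trans (×-congʳ d p≃0) (•-zero d))
        pointwise : ∀ u v → _·_ G (distance G u v) (Coupling.π c u v) +ᴿ f v • Coupling.π c u v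
                            ≃ᴿ f u • Coupling.π c u v
        pointwise u v with slack u v
        ... | inj₁ π≃0 = begin
          _·_ G (distance G u v) (Coupling.π c u v) +ᴿ f v • Coupling.π c u v
            ≈⟨ +ᴿ-cong (0· (distance G u v) π≃0) (×-congʳ (f v) π≃0) ⟩
          0ℝ +ᴿ f v • 0ℝ            ≈⟨ +ᴿ-identityˡ _ ⟩
          f v • 0ℝ                  ≈⟨ •-zero (f v) ⟩
          0ℝ                        ≈⟨ •-zero (f u) ⟨
          f u • 0ℝ                  ≈⟨ ×-congʳ (f u) π≃0 ⟨
          f u • Coupling.π c u v    ∎
        ... | inj₂ tight@(k , _ , fu≡k+fv) = begin
          _·_ G (distance G u v) (Coupling.π c u v) +ᴿ f v • Coupling.π c u v
            ≡⟨ cong (λ d → _·_ G d (Coupling.π c u v) +ᴿ f v • Coupling.π c u v) (tight⇒distance tight) ⟩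
          fromℕ k *ᴿ Coupling.π c u v +ᴿ f v • Coupling.π c u v
            ≈⟨ +ᴿ-congʳ (fromℕ-* k _) ⟩
          k • Coupling.π c u v +ᴿ f v • Coupling.π c u v
            ≈⟨ ×-homo-+ (Coupling.π c u v) k (f v) ⟨
          (k ℕ.+ f v) • Coupling.π c u v
            ≡⟨ cong (_• Coupling.π c u v) fu≡k+fv ⟨
          f u • Coupling.π c u v ∎

-- Counting neighbours

module ℕ∑ where
  open FiniteSum ℕ.+-0-commutativeMonoid public
  open import Algebra.Properties.CommutativeMonoid.Sum ℕ.+-0-commutativeMonoid public
    using (sum; sum-cong-≗) renaming (∑-distrib-+ to sum-distrib-+)

  sum-const : ∀ n c → sum {n} (λ _ → c) ≡ n * c
  sum-const zero    c = refl
  sum-const (suc n) c = cong (c ℕ.+_) (sum-const n c)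

𝟙 : Bool → ℕ
𝟙 b = if b then 1 else 0

length-filter-tabulate : ∀ {n} {A : Set} {P : A → Set} (P? : Unary.Decidable P) (g : Fin n → A) →
  length (filter P? (tabulate g)) ≡ ℕ∑.sum (λ i → 𝟙 (does (P? (g i))))
length-filter-tabulate {zero}  P? g = refl
length-filter-tabulate {suc n} P? g with ih ← length-filter-tabulate P? (λ i → g (suc i)) | does (P? (g zero))
... | true  = cong suc ih
... | false = ih

module _ {n} (J : Fin n → Bool) {u : Fin n} (Ju : T (J u)) where

  -- J holds at u itself, so the point mass at u restores the one term that excluding loops removes.
  suc-length-filter-≢ :
    suc (length (filter (λ v → ¬? (u Fin.≟ v) ×-dec T? (J v)) (allFin n))) ≡ ℕ∑.sum (λ v → 𝟙 (J v))
  suc-length-filter-≢ = begin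
    suc (length (filter (λ v → ¬? (u Fin.≟ v) ×-dec T? (J v)) (allFin n)))
      ≡⟨ cong suc (length-filter-tabulate (λ v → ¬? (u Fin.≟ v) ×-dec T? (J v)) (λ v → v)) ⟩
    1 ℕ.+ ℕ∑.sum (λ v → 𝟙 (not (does (u Fin.≟ v)) ∧ J v))
      ≡⟨ cong (ℕ._+ ℕ∑.sum (λ v → 𝟙 (not (does (u Fin.≟ v)) ∧ J v))) (ℕ∑.∑-only u 1) ⟨
    ℕ∑.sum (ℕ∑.only u 1) ℕ.+ ℕ∑.sum (λ v → 𝟙 (not (does (u Fin.≟ v)) ∧ J v))
      ≡⟨ ℕ∑.sum-distrib-+ (ℕ∑.only u 1) (λ v → 𝟙 (not (does (u Fin.≟ v)) ∧ J v)) ⟨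
    ℕ∑.sum (λ v → ℕ∑.only u 1 v ℕ.+ 𝟙 (not (does (u Fin.≟ v)) ∧ J v))
      ≡⟨ ℕ∑.sum-cong-≗ split ⟩
    ℕ∑.sum (λ v → 𝟙 (J v)) ∎
    where
    open ≡-Reasoning
    split : ∀ v → ℕ∑.only u 1 v ℕ.+ 𝟙 (not (does (u Fin.≟ v)) ∧ J v) ≡ 𝟙 (J v)
    split v with u Fin.≟ v
    ... | no  _    = refl
    ... | yes refl with true ← J v = refl

minDegree≡degree : ∀ {n} (G : SimpleGraph n) v →
  (∀ u → SimpleGraph.degree G v ≤ SimpleGraph.degree G u) →
  SimpleGraph.minDegree G ≡ SimpleGraph.degree G v
minDegree≡degree {n} G v v≤ = min≈v⁺ (∈-map⁺ degree (∈-allFin v))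
  (All.map⁺ (All.universal v≤ (allFin n)))
  -- The starting value n of the minimum must also be bounded below by the degree of v.
  (subst (degree v ≤_) (length-tabulate (λ i → i)) (length-filter (v ∼?_) (allFin n)))
  where open SimpleGraph G

-- The extremal graph

data Vertex (s : ℕ) : Set where
  left right hub       : Vertex s
  leftOnly rightOnly   : Fin (3 ℕ.+ s) → Vertex s
  common               : Fin s → Vertex s

-- One orientation of each edge; the loops are removed again in the graph G.
link : ∀ {s} → Vertex s → Vertex s → Bool
link left          left          = true
link left          right         = true
link right         right         = true
link right         (rightOnly _) = true
link (rightOnly _) (rightOnly _) = true
link (rightOnly _) hub           = true
link hub           hub           = true
link hub           (leftOnly _)  = true
link (leftOnly _)  (leftOnly _)  = true
link (leftOnly _)  left          = true
link (common _)    _             = true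
link _             _             = false

joined : ∀ {s} → Vertex s → Vertex s → Bool
joined v w = link v w ∨ link w v

-- Keeping the diagonal makes `joined v` constant on every clique, also the one containing v.
-- Degrees are therefore counted with v included.
joined-refl : ∀ {s} (v : Vertex s) → T (joined v v)
joined-refl left          = _
joined-refl right         = _
joined-refl hub           = _
joined-refl (leftOnly _)  = _
joined-refl (rightOnly _) = _
joined-refl (common _)    = _

-- An optimal Kantorovich potential for the edge left — right.
level : ∀ {s} → Vertex s → ℕ
level left          = 2
level (leftOnly _)  = 2
level right         = 1
level hub           = 1
level (common _)    = 1
level (rightOnly _) = 0

level-lipschitz : ∀ {s} (v w : Vertex s) → T (joined v w) → level v ≤ suc (level w)
level-lipschitz right         _              _ = s≤s z≤n
level-lipschitz hub           _              _ = s≤s z≤n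
level-lipschitz (common _)    _              _ = s≤s z≤n
level-lipschitz (rightOnly _) _              _ = z≤n
level-lipschitz left          left           _ = s≤s (s≤s z≤n)
level-lipschitz left          right          _ = s≤s (s≤s z≤n)
level-lipschitz left          hub            _ = s≤s (s≤s z≤n)
level-lipschitz left          (leftOnly _)   _ = s≤s (s≤s z≤n)
level-lipschitz left          (common _)     _ = s≤s (s≤s z≤n)
level-lipschitz (leftOnly _)  left           _ = s≤s (s≤s z≤n)
level-lipschitz (leftOnly _)  right          _ = s≤s (s≤s z≤n)
level-lipschitz (leftOnly _)  hub            _ = s≤s (s≤s z≤n)
level-lipschitz (leftOnly _)  (leftOnly _)   _ = s≤s (s≤s z≤n)
level-lipschitz (leftOnly _)  (common _)     _ = s≤s (s≤s z≤n)

-- The transport map for the portions of mass q. It is not a graph automorphism: it fixes `left` and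
-- `right` while exchanging their exclusive neighbours.
swap : ∀ {s} → Vertex s → Vertex s
swap (leftOnly i)  = rightOnly i
swap (rightOnly i) = leftOnly i
swap v             = v

swap-involutive : ∀ {s} (v : Vertex s) → swap (swap v) ≡ v
swap-involutive left          = refl
swap-involutive right         = refl
swap-involutive hub           = refl
swap-involutive (leftOnly _)  = refl
swap-involutive (rightOnly _) = refl
swap-involutive (common _)    = refl

-- Equal to 3(3 + s); the nesting mirrors the vertex classes, so sums and indices split block by
-- block.
order : ℕ → ℕ
order s = 3 ℕ.+ ((3 ℕ.+ s) ℕ.+ ((3 ℕ.+ s) ℕ.+ s))

encode : ∀ {s} → Vertex s → Fin (order s)
encode     left          = zero
encode     right         = suc zero
encode     hub           = suc (suc zero)
encode {s} (leftOnly i)  = suc (suc (suc (i ↑ˡ ((3 ℕ.+ s) ℕ.+ s))))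
encode {s} (rightOnly i) = suc (suc (suc ((3 ℕ.+ s) ↑ʳ (i ↑ˡ s))))
encode {s} (common i)    = suc (suc (suc ((3 ℕ.+ s) ↑ʳ ((3 ℕ.+ s) ↑ʳ i))))

decode : ∀ {s} → Fin (order s) → Vertex s
decode     zero                = left
decode     (suc zero)          = right
decode     (suc (suc zero))    = hub
decode {s} (suc (suc (suc i))) =
  [ leftOnly , (λ j → [ rightOnly , common ]′ (splitAt (3 ℕ.+ s) j)) ]′ (splitAt (3 ℕ.+ s) i)

decode-encode : ∀ {s} (v : Vertex s) → decode (encode v) ≡ v
decode-encode     left          = refl
decode-encode     right         = refl
decode-encode     hub           = refl
decode-encode {s} (leftOnly i)  rewrite Fin.splitAt-↑ˡ (3 ℕ.+ s) i ((3 ℕ.+ s) ℕ.+ s) = refl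
decode-encode {s} (rightOnly i)
  rewrite Fin.splitAt-↑ʳ (3 ℕ.+ s) ((3 ℕ.+ s) ℕ.+ s) (i ↑ˡ s) | Fin.splitAt-↑ˡ (3 ℕ.+ s) i s = refl
decode-encode {s} (common i)
  rewrite Fin.splitAt-↑ʳ (3 ℕ.+ s) ((3 ℕ.+ s) ℕ.+ s) ((3 ℕ.+ s) ↑ʳ i) | Fin.splitAt-↑ʳ (3 ℕ.+ s) s i = refl

encode-decode : ∀ {s} (i : Fin (order s)) → encode (decode i) ≡ i
encode-decode     zero                = refl
encode-decode     (suc zero)          = refl
encode-decode     (suc (suc zero))    = refl
encode-decode {s} (suc (suc (suc i))) with splitAt (3 ℕ.+ s) i in eq
... | inj₁ j = cong (λ k → suc (suc (suc k))) (Fin.splitAt⁻¹-↑ˡ eq)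
... | inj₂ k with splitAt (3 ℕ.+ s) k in eq′
...   | inj₁ j = cong (λ k → suc (suc (suc k)))
                   (trans (cong ((3 ℕ.+ s) ↑ʳ_) (Fin.splitAt⁻¹-↑ˡ eq′)) (Fin.splitAt⁻¹-↑ʳ eq))
...   | inj₂ j = cong (λ k → suc (suc (suc k)))
                   (trans (cong ((3 ℕ.+ s) ↑ʳ_) (Fin.splitAt⁻¹-↑ʳ eq′)) (Fin.splitAt⁻¹-↑ʳ eq))

every-vertex : ∀ {s} (P : Fin (order s) → Set) → (∀ v → P (encode v)) → ∀ i → P i
every-vertex P p i = subst P (encode-decode i) (p (decode i))

module VertexSum {c ℓ} (M : CommutativeMonoid c ℓ) where
  open CommutativeMonoid M renaming (trans to trans-≈)
  open FiniteSum M using (∑-↑)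
  open import Algebra.Properties.CommutativeMonoid.Sum M using (sum)

  ∑-vertices : ∀ {s} (g : Fin (order s) → Carrier) →
    sum g ≈ g (encode left) ∙ (g (encode right) ∙ (g (encode hub)
            ∙ (sum (λ i → g (encode (leftOnly i)))
            ∙ (sum (λ i → g (encode (rightOnly i))) ∙ sum (λ i → g (encode (common i)))))))
  ∑-vertices {s} g = ∙-congˡ (∙-congˡ (∙-congˡ (trans-≈
    (∑-↑ (3 ℕ.+ s) (λ i → g (suc (suc (suc i)))))
    (∙-congˡ (∑-↑ (3 ℕ.+ s) (λ i → g (suc (suc (suc ((3 ℕ.+ s) ↑ʳ i))))))))))

module Extremal (s : ℕ) where

  G : SimpleGraph (order s)
  G = record
    { _∼_         = λ u v → ¬ u ≡ v × T (joined (decode u) (decode v))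
    ; _∼?_        = λ u v → ¬? (u Fin.≟ v) ×-dec T? (joined (decode u) (decode v))
    ; symmetric   = λ {u} {v} (u≢v , j) → (λ v≡u → u≢v (sym v≡u))
                    , subst T (∨-comm (link (decode u) (decode v)) (link (decode v) (decode u))) j
    ; irreflexive = λ u≡v (u≢v , _) → u≢v u≡v
    }

  open SimpleGraph G public using (_∼_)

  encode-injective : ∀ {v w : Vertex s} → encode v ≡ encode w → v ≡ w
  encode-injective {v} {w} eq = trans (sym (decode-encode v)) (trans (cong decode eq) (decode-encode w))

  encode-∼ : ∀ {v w : Vertex s} → ¬ v ≡ w → T (joined v w) → encode v ∼ encode w
  encode-∼ {v} {w} v≢w j = (λ eq → v≢w (encode-injective eq))
    , subst T (sym (cong₂ joined (decode-encode v) (decode-encode w))) j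

  ∼-encode : ∀ {v w : Vertex s} → encode v ∼ encode w → T (joined v w)
  ∼-encode {v} {w} (_ , j) = subst T (cong₂ joined (decode-encode v) (decode-encode w)) j

  joined-leftOnly : ∀ (v : Vertex s) i → joined v (leftOnly i) ≡ joined v (leftOnly zero)
  joined-leftOnly left          _ = refl
  joined-leftOnly right         _ = refl
  joined-leftOnly hub           _ = refl
  joined-leftOnly (leftOnly _)  _ = refl
  joined-leftOnly (rightOnly _) _ = refl
  joined-leftOnly (common _)    _ = refl

  joined-rightOnly : ∀ (v : Vertex s) i → joined v (rightOnly i) ≡ joined v (rightOnly zero)
  joined-rightOnly left          _ = refl
  joined-rightOnly right         _ = refl
  joined-rightOnly hub           _ = refl
  joined-rightOnly (leftOnly _)  _ = refl
  joined-rightOnly (rightOnly _) _ = refl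
  joined-rightOnly (common _)    _ = refl

  -- Size of the closed neighbourhood, one representative deciding for each class. The `common`
  -- block always counts in full and may be empty, hence has no representative.
  closedDegree : Vertex s → ℕ
  closedDegree v = 𝟙 (joined v left) ℕ.+ (𝟙 (joined v right) ℕ.+ (𝟙 (joined v hub)
    ℕ.+ ((3 ℕ.+ s) * 𝟙 (joined v (leftOnly zero))
    ℕ.+ ((3 ℕ.+ s) * 𝟙 (joined v (rightOnly zero)) ℕ.+ s * 1))))

  suc-degree : ∀ v → suc (SimpleGraph.degree G (encode v)) ≡ closedDegree v
  suc-degree v = begin
    suc (SimpleGraph.degree G (encode v))
      ≡⟨ suc-length-filter-≢ (λ i → joined (decode (encode v)) (decode i)) {encode v}
           (joined-refl (decode (encode v))) ⟩
    ℕ∑.sum (λ i → 𝟙 (joined (decode (encode v)) (decode i)))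
      ≡⟨ cong (λ w → ℕ∑.sum (λ i → 𝟙 (joined w (decode i)))) (decode-encode v) ⟩
    ℕ∑.sum (λ i → 𝟙 (joined v (decode i)))
      ≡⟨ VertexSum.∑-vertices ℕ.+-0-commutativeMonoid (λ i → 𝟙 (joined v (decode i))) ⟩
    _ ≡⟨ cong (λ k → 𝟙 (joined v left) ℕ.+ (𝟙 (joined v right) ℕ.+ (𝟙 (joined v hub) ℕ.+ k)))
           (cong₂ ℕ._+_ (block (3 ℕ.+ s) leftOnly _ (joined-leftOnly v))
             (cong₂ ℕ._+_ (block (3 ℕ.+ s) rightOnly _ (joined-rightOnly v))
               (block s common true λ i → ∨-zeroʳ (link v (common i))))) ⟩
    closedDegree v ∎
    where
    open ≡-Reasoning
    block : ∀ n (h : Fin n → Vertex s) b → (∀ i → joined v (h i) ≡ b) →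
            ℕ∑.sum (λ i → 𝟙 (joined v (decode (encode (h i))))) ≡ n * 𝟙 b
    block n h b eq = trans
      (ℕ∑.sum-cong-≗ λ i → cong 𝟙 (trans (cong (joined v) (decode-encode (h i))) (eq i)))
      (ℕ∑.sum-const n (𝟙 b))

  D : ℕ
  D = 4 ℕ.+ (s ℕ.+ s)

  closedDegree-left : closedDegree left ≡ suc D
  closedDegree-left rewrite ℕ.*-identityʳ s | ℕ.*-zeroʳ s = refl

  closedDegree-right : closedDegree right ≡ suc D
  closedDegree-right rewrite ℕ.*-identityʳ s | ℕ.*-zeroʳ s = refl

  -- Equality suc D holds for `left`, `right`, `leftOnly` and `rightOnly`; the closed neighbourhoods
  -- of `hub` and `common` have 7 + 3s and 9 + 3s vertices.
  D<closedDegree : ∀ v → D ℕ.< closedDegree v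
  D<closedDegree left  = ℕ.≤-reflexive (sym closedDegree-left)
  D<closedDegree right = ℕ.≤-reflexive (sym closedDegree-right)
  D<closedDegree hub rewrite ℕ.*-identityʳ s =
    ℕ.+-monoʳ-≤ 4 (ℕ.≤-trans (ℕ.m≤n+m (1 ℕ.+ (s ℕ.+ s)) 2) (ℕ.m≤n+m (3 ℕ.+ (s ℕ.+ s)) s))
  D<closedDegree (leftOnly _) rewrite ℕ.*-identityʳ s | ℕ.*-zeroʳ s = ℕ.≤-refl
  D<closedDegree (rightOnly _) rewrite ℕ.*-identityʳ s | ℕ.*-zeroʳ s = ℕ.≤-refl
  D<closedDegree (common _) rewrite ℕ.*-identityʳ s =
    ℕ.+-monoʳ-≤ 5 (ℕ.≤-trans (ℕ.m≤n+m (s ℕ.+ s) 4) (ℕ.+-monoʳ-≤ 1 (ℕ.m≤n+m (3 ℕ.+ (s ℕ.+ s)) s)))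

  degree-left : SimpleGraph.degree G (encode left) ≡ D
  degree-left = ℕ.suc-injective (trans (suc-degree left) closedDegree-left)

  degree-right : SimpleGraph.degree G (encode right) ≡ D
  degree-right = ℕ.suc-injective (trans (suc-degree right) closedDegree-right)

  D≤degree : ∀ v → D ≤ SimpleGraph.degree G (encode v)
  D≤degree v = ℕ.≤-pred (subst (D ℕ.<_) (sym (suc-degree v)) (D<closedDegree v))

  minDegree≡D : SimpleGraph.minDegree G ≡ D
  minDegree≡D = trans (minDegree≡degree G (encode left) degree-left≤) degree-left
    where
    degree-left≤ : ∀ u → SimpleGraph.degree G (encode left) ≤ SimpleGraph.degree G u
    degree-left≤ = every-vertex (λ u → SimpleGraph.degree G (encode left) ≤ SimpleGraph.degree G u)
      λ v → subst (_≤ SimpleGraph.degree G (encode v)) (sym degree-left) (D≤degree v)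

-- Cancellation and differences of reals

+ᴿ-cancelʳ-≤ : ∀ {x y} z → x +ᴿ z ≤ᴿ y +ᴿ z → x ≤ᴿ y
+ᴿ-cancelʳ-≤ {x} {y} z h = mk≤ λ ε → map-eventually
  (λ {n} p → transfer-≤ p (rearrange (seq x n) (seq y n) (seq z n) ε)) (eventually-≤ h ε)
  where
  open +-*-Solver
  rearrange : ∀ a b c e → ((b ℚ.+ c) ℚ.+ e) ℚ.- (a ℚ.+ c) ≡ (b ℚ.+ e) ℚ.- a
  rearrange = solve 4 (λ a b c e → ((b :+ c) :+ e) :- (a :+ c) := (b :+ e) :- a) refl

+ᴿ-cancelʳ : ∀ {x y} z → x +ᴿ z ≃ᴿ y +ᴿ z → x ≃ᴿ y
+ᴿ-cancelʳ z h = ≤ᴿ-antisym (+ᴿ-cancelʳ-≤ z (≃ᴿ⇒≤ᴿ h)) (+ᴿ-cancelʳ-≤ z (≃ᴿ⇒≤ᴿ (≃ᴿ-sym h)))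

x-y+y≃x : ∀ x y → (x -ᴿ y) +ᴿ y ≃ᴿ x
x-y+y≃x x y = ≗⇒≃ᴿ λ n → cancel (seq x n) (seq y n)
  where
  open +-*-Solver
  cancel : ∀ a b → (a ℚ.- b) ℚ.+ b ≡ a
  cancel = solve 2 (λ a b → (a :- b) :+ b := a) refl

x≤y⇒0≤y-x : ∀ {x y} → x ≤ᴿ y → 0ℝ ≤ᴿ y -ᴿ x
x≤y⇒0≤y-x {x} {y} x≤y = +ᴿ-cancelʳ-≤ x (begin
  0ℝ +ᴿ x           ≈⟨ +ᴿ-identityˡ x ⟩
  x                 ≤⟨ x≤y ⟩
  y                 ≈⟨ x-y+y≃x y x ⟨
  (y -ᴿ x) +ᴿ x     ∎)
  where open ≤ᴿ-Reasoning

x≃z+y⇒-z≃y-x : ∀ {x y z} → x ≃ᴿ z +ᴿ y → -ᴿ z ≃ᴿ y -ᴿ x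
x≃z+y⇒-z≃y-x {x} {y} {z} (mk≃ h) = mk≃ λ ε → map-eventually
  (λ {n} → subst (λ d → ℚ.∣ d ∣ ℚ.≤ ε) (rearrange (seq x n) (seq y n) (seq z n))) (h ε)
  where
  open +-*-Solver
  rearrange : ∀ a b c → a ℚ.- (c ℚ.+ b) ≡ (ℚ.- c) ℚ.- (b ℚ.- a)
  rearrange = solve 3 (λ a b c → a :- (c :+ b) := (:- c) :- (b :- a)) refl

open import Algebra.Solver.CommutativeMonoid +ᴿ-commutativeMonoid using (_⊕_; _⊜_)
  renaming (solve to solve-+ᴿ; id to 𝟘)

-- Values of the measures at a vertex

module _ {n} (G : SimpleGraph n) (α : ℝ) (x : Fin n) .{{_ : NonZero (SimpleGraph.degree G x)}} where
  open SimpleGraph G using (_∼_; _∼?_; irreflexive)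

  μ-self : μ G α x x ≡ α
  μ-self with x Fin.≟ x | x ∼? x
  ... | yes _  | _ = refl
  ... | no x≢x | _ = contradiction refl x≢x

  μ-adjacent : ∀ {y} → x ∼ y → μ G α x y ≡ (1ℝ -ᴿ α) *ᴿ fromℚ (+ 1 ℚ./ SimpleGraph.degree G x)
  μ-adjacent {y} x∼y with y Fin.≟ x | x ∼? y
  ... | yes y≡x | _      = contradiction x∼y (irreflexive (sym y≡x))
  ... | no _    | yes _  = refl
  ... | no _    | no x≁y = contradiction x∼y x≁y

  μ-elsewhere : ∀ {y} → ¬ y ≡ x → ¬ x ∼ y → μ G α x y ≡ 0ℝ
  μ-elsewhere {y} y≢x x≁y with y Fin.≟ x | x ∼? y
  ... | yes y≡x | _       = contradiction y≡x y≢x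
  ... | no _    | yes x∼y = contradiction x∼y x≁y
  ... | no _    | no _    = refl

-- The irrelevant instances coincide once a and b do, so a degree can be replaced by `D` under the
-- division.
1/-cong : ∀ {a b} .{{_ : NonZero a}} .{{_ : NonZero b}} → a ≡ b → + 1 ℚ./ a ≡ + 1 ℚ./ b
1/-cong refl = refl

-- The optimal plan and its cost

module Transport (s : ℕ) where
  open Extremal s

  x₀ y₀ : Fin (order s)
  x₀ = encode left
  y₀ = encode right

  x₀∼y₀ : x₀ ∼ y₀
  x₀∼y₀ = encode-∼ {left} {right} (λ ()) _

  potential : Fin (order s) → ℕ
  potential u = level (decode u)

  open Duality G potential

  potential-lipschitz : ∀ {u v} → u ∼ v → potential u ≤ suc (potential v)
  potential-lipschitz {u} {v} (_ , j) = level-lipschitz (decode u) (decode v) j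

  σ : Fin (order s) → Fin (order s)
  σ u = encode (swap (decode u))

  σ-encode : ∀ v → σ (encode v) ≡ encode (swap v)
  σ-encode v = cong (λ w → encode (swap w)) (decode-encode v)

  σ-involutive : ∀ u → σ (σ u) ≡ u
  σ-involutive u = trans (σ-encode (swap (decode u)))
    (trans (cong encode (swap-involutive (decode u))) (encode-decode u))

  module Plan (α q : ℝ) (0≤q : 0ℝ ≤ᴿ q) (q≤α : q ≤ᴿ α) (α≤1 : α ≤ᴿ 1ℝ) where

    -- `mass` is `source` with the excess α - q removed at `left`; composed with `swap` it is
    -- `target` with the same excess removed at `right`.
    source target mass : Vertex s → ℝ
    source left          = α
    source right         = q
    source hub           = 0ℝ
    source (leftOnly _)  = q
    source (rightOnly _) = 0ℝ
    source (common _)    = q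
    target left          = q
    target right         = α
    target hub           = 0ℝ
    target (leftOnly _)  = 0ℝ
    target (rightOnly _) = q
    target (common _)    = q
    mass left            = q
    mass right           = q
    mass hub             = 0ℝ
    mass (leftOnly _)    = q
    mass (rightOnly _)   = 0ℝ
    mass (common _)      = q

    0≤mass : ∀ v → 0ℝ ≤ᴿ mass v
    0≤mass left          = 0≤q
    0≤mass right         = 0≤q
    0≤mass hub           = ≤ᴿ-refl
    0≤mass (leftOnly _)  = 0≤q
    0≤mass (rightOnly _) = ≤ᴿ-refl
    0≤mass (common _)    = 0≤q

    mass≤q : ∀ v → mass v ≤ᴿ q
    mass≤q left          = ≤ᴿ-refl
    mass≤q right         = ≤ᴿ-refl
    mass≤q hub           = 0≤q
    mass≤q (leftOnly _)  = ≤ᴿ-refl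
    mass≤q (rightOnly _) = 0≤q
    mass≤q (common _)    = ≤ᴿ-refl

    excess : ℝ
    excess = α -ᴿ q

    0≤excess : 0ℝ ≤ᴿ excess
    0≤excess = x≤y⇒0≤y-x q≤α

    q+excess≃α : q +ᴿ excess ≃ᴿ α
    q+excess≃α = ≃ᴿ-trans (+ᴿ-comm q excess) (x-y+y≃x α q)

    -- Every vertex of the support of source sends mass q along σ, and the
    -- rest of the mass of x₀ moves to y₀.
    along extra plan : Fin (order s) → Fin (order s) → ℝ
    along u v = only (σ u) (mass (decode u)) v
    extra u v = only x₀ (only y₀ excess v) u
    plan u v = along u v +ᴿ extra u v

    plan≥0 : ∀ u v → 0ℝ ≤ᴿ plan u v
    plan≥0 u v = +ᴿ-nonneg (only-nonneg (σ u) (0≤mass (decode u)) v)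
                           (only-nonneg x₀ (only-nonneg y₀ 0≤excess v) u)

    plan≤1 : ∀ u v → plan u v ≤ᴿ 1ℝ
    plan≤1 u v = begin
      plan u v                            ≤⟨ +ᴿ-mono-≤ (only-≤ (σ u) (0≤mass (decode u)) v)
                                                       (only-≤ x₀ (only-nonneg y₀ 0≤excess v) u) ⟩
      mass (decode u) +ᴿ only y₀ excess v ≤⟨ +ᴿ-mono-≤ (mass≤q (decode u)) (only-≤ y₀ 0≤excess v) ⟩
      q +ᴿ excess                         ≈⟨ q+excess≃α ⟩
      α                                   ≤⟨ α≤1 ⟩
      1ℝ                                  ∎
      where open ≤ᴿ-Reasoning

    ∑-extra : ∀ u → ∑ (extra u) ≃ᴿ only x₀ excess u
    ∑-extra u with does (x₀ Fin.≟ u)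
    ... | true  = ∑-only y₀ excess
    ... | false = sum-replicate-zero (order s)

    -- As σ is an involution, σ u = v exactly when σ v = u. A column of `along` is thus again a
    -- point mass, and column sums follow like row sums.
    along-flip : ∀ u v → along u v ≡ only (σ v) (mass (decode (σ v))) u
    along-flip u v with σ u Fin.≟ v | σ v Fin.≟ u
    ... | yes refl | yes _    = cong (λ w → mass (decode w)) (sym (σ-involutive u))
    ... | yes refl | no σσu≢u = contradiction (σ-involutive u) σσu≢u
    ... | no σσv≢v | yes refl = contradiction (σ-involutive v) σσv≢v
    ... | no _     | no _     = refl

    row : ∀ v → ∑ (plan (encode v)) ≃ᴿ source v
    row v = begin
      ∑ (plan (encode v))                                ≈⟨ ∑-distrib-+ (along (encode v)) (extra (encode v)) ⟩
      ∑ (along (encode v)) +ᴿ ∑ (extra (encode v))       ≈⟨ +ᴿ-cong (∑-only (σ (encode v)) _) (∑-extra (encode v)) ⟩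
      mass (decode (encode v)) +ᴿ only x₀ excess (encode v)
        ≡⟨ cong (λ w → mass w +ᴿ only x₀ excess (encode v)) (decode-encode v) ⟩
      mass v +ᴿ only x₀ excess (encode v)                ≈⟨ total v ⟩
      source v                                           ∎
      where
      open ≃ᴿ-Reasoning
      total : ∀ v → mass v +ᴿ only x₀ excess (encode v) ≃ᴿ source v
      total left          = q+excess≃α
      total right         = +ᴿ-identityʳ q
      total hub           = +ᴿ-identityʳ 0ℝ
      total (leftOnly _)  = +ᴿ-identityʳ q
      total (rightOnly _) = +ᴿ-identityʳ 0ℝ
      total (common _)    = +ᴿ-identityʳ q

    column : ∀ v → ∑ (λ u → plan u (encode v)) ≃ᴿ target v
    column v = begin
      ∑ (λ u → plan u (encode v))
        ≈⟨ ∑-distrib-+ (λ u → along u (encode v)) (λ u → extra u (encode v)) ⟩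
      ∑ (λ u → along u (encode v)) +ᴿ ∑ (λ u → extra u (encode v))
        ≈⟨ +ᴿ-cong (sum-cong-≋ λ u → ≡⇒≃ᴿ (along-flip u (encode v))) (∑-only x₀ _) ⟩
      ∑ (only (σ (encode v)) (mass (decode (σ (encode v))))) +ᴿ only y₀ excess (encode v)
        ≈⟨ +ᴿ-congʳ (∑-only (σ (encode v)) _) ⟩
      mass (decode (σ (encode v))) +ᴿ only y₀ excess (encode v)
        ≡⟨ cong (λ w → mass w +ᴿ only y₀ excess (encode v))
             (trans (cong decode (σ-encode v)) (decode-encode (swap v))) ⟩
      mass (swap v) +ᴿ only y₀ excess (encode v)
        ≈⟨ total v ⟩
      target v ∎
      where
      open ≃ᴿ-Reasoning
      total : ∀ v → mass (swap v) +ᴿ only y₀ excess (encode v) ≃ᴿ target v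
      total left          = +ᴿ-identityʳ q
      total right         = q+excess≃α
      total hub           = +ᴿ-identityʳ 0ℝ
      total (leftOnly _)  = +ᴿ-identityʳ 0ℝ
      total (rightOnly _) = +ᴿ-identityʳ q
      total (common _)    = +ᴿ-identityʳ q

    tight : ∀ k v w → SimpleGraph.Walk G k (encode v) (encode w) → level v ≡ k ℕ.+ level w →
            Tight (encode v) (encode w)
    tight k v w walk eq = k , walk , trans (cong level (decode-encode v))
      (trans eq (cong (λ v → k ℕ.+ level v) (sym (decode-encode w))))

    along-slack : ∀ v w → along (encode v) w ≃ᴿ 0ℝ ⊎ Tight (encode v) w
    along-slack v w with σ (encode v) Fin.≟ w
    ... | no  _    = inj₁ ≃ᴿ-refl
    ... | yes refl = subst (λ w → mass w ≃ᴿ 0ℝ ⊎ Tight (encode v) (encode (swap w))) (sym (decode-encode v)) (stay v)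
      where
      stay : ∀ v → mass v ≃ᴿ 0ℝ ⊎ Tight (encode v) (encode (swap v))
      stay left          = inj₂ (tight 0 left left refl refl)
      stay right         = inj₂ (tight 0 right right refl refl)
      stay hub           = inj₁ ≃ᴿ-refl
      -- The route through `hub` exists for every s and descends the levels 2, 1, 0.
      stay (leftOnly i)  = inj₂ (tight 2 (leftOnly i) (rightOnly i)
        (encode hub , encode-∼ {leftOnly i} {hub} (λ ()) _
        , encode (rightOnly i) , encode-∼ {hub} {rightOnly i} (λ ()) _ , refl) refl)
      stay (rightOnly _) = inj₁ ≃ᴿ-refl
      stay (common i)    = inj₂ (tight 0 (common i) (common i) refl refl)

    extra-slack : ∀ u v → extra u v ≃ᴿ 0ℝ ⊎ Tight u v
    extra-slack u v with x₀ Fin.≟ u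
    ... | no  _    = inj₁ ≃ᴿ-refl
    ... | yes refl with y₀ Fin.≟ v
    ...   | no  _    = inj₁ ≃ᴿ-refl
    ...   | yes refl = inj₂ (tight 1 left right (y₀ , x₀∼y₀ , refl) refl)

    slack : ∀ u v → plan u v ≃ᴿ 0ℝ ⊎ Tight u v
    slack u v with every-vertex (λ u → along u v ≃ᴿ 0ℝ ⊎ Tight u v) (λ w → along-slack w v) u
                 | extra-slack u v
    ... | inj₂ t | _      = inj₂ t
    ... | inj₁ _ | inj₂ t = inj₂ t
    ... | inj₁ p | inj₁ r = inj₁ (≃ᴿ-trans (+ᴿ-cong p r) (+ᴿ-identityˡ 0ℝ))

    ∑-potential : (ν : Fin (order s) → ℝ) (τ : Vertex s → ℝ) → (∀ v → ν (encode v) ≃ᴿ τ v) →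
      ∑ (λ u → potential u • ν u) ≃ᴿ 2 • τ left +ᴿ (1 • τ right +ᴿ (1 • τ hub
        +ᴿ (∑ (λ i → 2 • τ (leftOnly i)) +ᴿ (∑ (λ i → 0 • τ (rightOnly i))
        +ᴿ ∑ (λ i → 1 • τ (common i))))))
    ∑-potential ν τ ν≃τ = ≃ᴿ-trans
      (VertexSum.∑-vertices +ᴿ-commutativeMonoid (λ u → potential u • ν u))
      (+ᴿ-cong (term left) (+ᴿ-cong (term right) (+ᴿ-cong (term hub)
        (+ᴿ-cong (sum-cong-≋ λ i → term (leftOnly i))
          (+ᴿ-cong (sum-cong-≋ λ i → term (rightOnly i)) (sum-cong-≋ λ i → term (common i)))))))
      where
      term : ∀ v → potential (encode v) • ν (encode v) ≃ᴿ level v • τ v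
      term v = ≃ᴿ-trans (≡⇒≃ᴿ (cong (λ w → level w • ν (encode v)) (decode-encode v)))
                        (×-congʳ (level v) (ν≃τ v))

    -- w is (α - q) + 2(3 + s)q with the subtraction cleared: 5 = 2 · 3 - 1, and S stands for sq.
    S w : ℝ
    S = s • q
    w = α +ᴿ (5 • q +ᴿ (S +ᴿ S))

    s•1•q≃S : s • (1 • q) ≃ᴿ S
    s•1•q≃S = ×-congʳ s (+ᴿ-identityʳ q)

    s•2•q≃S+S : s • (2 • q) ≃ᴿ S +ᴿ S
    s•2•q≃S+S = ≃ᴿ-trans (×-distrib-+ q (1 • q) s) (+ᴿ-congˡ s•1•q≃S)

    module _ {μ₁ μ₂ : Fin (order s) → ℝ}
             (μ₁≃source : ∀ v → μ₁ (encode v) ≃ᴿ source v)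
             (μ₂≃target : ∀ v → μ₂ (encode v) ≃ᴿ target v) where

      coupling : Coupling G μ₁ μ₂
      coupling = record
        { π         = plan
        ; π≥0       = plan≥0
        ; π≤1       = plan≤1
        ; marginal₁ = every-vertex (λ u → ∑ (plan u) ≃ᴿ μ₁ u)
                        λ v → ≃ᴿ-trans (row v) (≃ᴿ-sym (μ₁≃source v))
        ; marginal₂ = every-vertex (λ v → ∑ (λ u → plan u v) ≃ᴿ μ₂ v)
                        λ v → ≃ᴿ-trans (column v) (≃ᴿ-sym (μ₂≃target v))
        }

      -- The 7 is 1 from `right` plus 2 · 3 from `leftOnly`; the three S are two from `leftOnly` and
      -- one from `common`.
      ∑-source : ∑ (λ u → potential u • μ₁ u) ≃ᴿ (2 • α +ᴿ 7 • q) +ᴿ (S +ᴿ (S +ᴿ S))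
      ∑-source = begin
        ∑ (λ u → potential u • μ₁ u)
          ≈⟨ ∑-potential μ₁ source μ₁≃source ⟩
        2 • α +ᴿ (1 • q +ᴿ (1 • 0ℝ +ᴿ (∑ {3 ℕ.+ s} (λ _ → 2 • q)
          +ᴿ (∑ {3 ℕ.+ s} (λ _ → 0ℝ) +ᴿ ∑ {s} (λ _ → 1 • q)))))
          ≈⟨ +ᴿ-congˡ (+ᴿ-congˡ (+ᴿ-congˡ (+ᴿ-cong
               (≃ᴿ-trans (sum-replicate (3 ℕ.+ s)) (+ᴿ-congˡ (+ᴿ-congˡ (+ᴿ-congˡ s•2•q≃S+S))))
               (+ᴿ-cong (sum-replicate-zero (3 ℕ.+ s)) (≃ᴿ-trans (sum-replicate s) s•1•q≃S))))) ⟩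
        2 • α +ᴿ (1 • q +ᴿ (1 • 0ℝ +ᴿ ((2 • q +ᴿ (2 • q +ᴿ (2 • q +ᴿ (S +ᴿ S)))) +ᴿ (0ℝ +ᴿ S))))
          ≈⟨ solve-+ᴿ 3 (λ a q S →
               (a ⊕ (a ⊕ 𝟘)) ⊕ ((q ⊕ 𝟘) ⊕ ((𝟘 ⊕ 𝟘) ⊕
                 (((q ⊕ (q ⊕ 𝟘)) ⊕ ((q ⊕ (q ⊕ 𝟘)) ⊕ ((q ⊕ (q ⊕ 𝟘)) ⊕ (S ⊕ S)))) ⊕ (𝟘 ⊕ S))))
               ⊜ ((a ⊕ (a ⊕ 𝟘)) ⊕ (q ⊕ (q ⊕ (q ⊕ (q ⊕ (q ⊕ (q ⊕ (q ⊕ 𝟘)))))))) ⊕ (S ⊕ (S ⊕ S)))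
               ≃ᴿ-refl α q S ⟩
        (2 • α +ᴿ 7 • q) +ᴿ (S +ᴿ (S +ᴿ S)) ∎
        where open ≃ᴿ-Reasoning

      ∑-target : ∑ (λ u → potential u • μ₂ u) ≃ᴿ (α +ᴿ 2 • q) +ᴿ S
      ∑-target = begin
        ∑ (λ u → potential u • μ₂ u)
          ≈⟨ ∑-potential μ₂ target μ₂≃target ⟩
        2 • q +ᴿ (1 • α +ᴿ (1 • 0ℝ +ᴿ (∑ {3 ℕ.+ s} (λ _ → 2 • 0ℝ)
          +ᴿ (∑ {3 ℕ.+ s} (λ _ → 0ℝ) +ᴿ ∑ {s} (λ _ → 1 • q)))))
          ≈⟨ +ᴿ-congˡ (+ᴿ-congˡ (+ᴿ-congˡ (+ᴿ-cong
               (≃ᴿ-trans (sum-cong-≋ {3 ℕ.+ s} λ _ → •-zero 2) (sum-replicate-zero (3 ℕ.+ s)))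
               (+ᴿ-cong (sum-replicate-zero (3 ℕ.+ s)) (≃ᴿ-trans (sum-replicate s) s•1•q≃S))))) ⟩
        2 • q +ᴿ (1 • α +ᴿ (1 • 0ℝ +ᴿ (0ℝ +ᴿ (0ℝ +ᴿ S))))
          ≈⟨ solve-+ᴿ 3 (λ a q S →
               (q ⊕ (q ⊕ 𝟘)) ⊕ ((a ⊕ 𝟘) ⊕ ((𝟘 ⊕ 𝟘) ⊕ (𝟘 ⊕ (𝟘 ⊕ S))))
               ⊜ (a ⊕ (q ⊕ (q ⊕ 𝟘))) ⊕ S)
               ≃ᴿ-refl α q S ⟩
        (α +ᴿ 2 • q) +ᴿ S ∎
        where open ≃ᴿ-Reasoning

      w+∑-target≃∑-source : w +ᴿ ∑ (λ u → potential u • μ₂ u) ≃ᴿ ∑ (λ u → potential u • μ₁ u)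
      w+∑-target≃∑-source = begin
        w +ᴿ ∑ (λ u → potential u • μ₂ u)       ≈⟨ +ᴿ-congˡ ∑-target ⟩
        w +ᴿ ((α +ᴿ 2 • q) +ᴿ S)
          ≈⟨ solve-+ᴿ 3 (λ a q S →
               (a ⊕ ((q ⊕ (q ⊕ (q ⊕ (q ⊕ (q ⊕ 𝟘))))) ⊕ (S ⊕ S))) ⊕ ((a ⊕ (q ⊕ (q ⊕ 𝟘))) ⊕ S)
               ⊜ ((a ⊕ (a ⊕ 𝟘)) ⊕ (q ⊕ (q ⊕ (q ⊕ (q ⊕ (q ⊕ (q ⊕ (q ⊕ 𝟘)))))))) ⊕ (S ⊕ (S ⊕ S)))
               ≃ᴿ-refl α q S ⟩
        (2 • α +ᴿ 7 • q) +ᴿ (S +ᴿ (S +ᴿ S))     ≈⟨ ∑-source ⟨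
        ∑ (λ u → potential u • μ₁ u)            ∎
        where open ≃ᴿ-Reasoning

      -- Weak duality bounds every cost from below by w and the plan attains w, so ε only supplies
      -- strictness.
      isW₁ : IsW₁ G μ₁ μ₂ w
      isW₁ = (λ c finite → +ᴿ-cancelʳ-≤ _ (≤ᴿ-trans (≃ᴿ⇒≤ᴿ w+∑-target≃∑-source)
                                            (weak-duality potential-lipschitz c finite)))
           , λ ε 0<ε → coupling , slackness⇒finite potential-lipschitz coupling slack
               , ≃ᴿ⇒<+ε (+ᴿ-cancelʳ _ (≃ᴿ-trans (strong-duality potential-lipschitz coupling slack)
                                                 (≃ᴿ-sym w+∑-target≃∑-source))) 0<ε

-- Curvature of the edge

module Curvature (s : ℕ) where
  open Extremal s
  open Transport s

  r : ℚ
  r = + 1 ℚ./ D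

  r>0 : ℚ.Positive r
  r>0 = ℚ.normalize-pos 1 D

  κ : ℝ
  κ = fromℚ (ℚ.- r)

  κ<0 : κ <ᴿ 0ℝ
  κ<0 = mk< r r>0 (0 , λ _ _ → ℚ.≤-reflexive (double-neg r))
    where
    open +-*-Solver
    double-neg : ∀ r → r ≡ 0ℚ ℚ.- (ℚ.- r)
    double-neg = solve 1 (λ r → r := con 0ℚ :- (:- r)) refl

  module _ (α : ℝ) (½<α : 1ℝ -ᴿ fromℚ ℚ.½ <ᴿ α) (α<1 : α <ᴿ 1ℝ) where

    q : ℝ
    q = (1ℝ -ᴿ α) *ᴿ fromℚ r

    D•q≃1-α : D • q ≃ᴿ 1ℝ -ᴿ α
    D•q≃1-α = •-fraction D (1ℝ -ᴿ α)

    0≤q : 0ℝ ≤ᴿ q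
    0≤q = eventually-≤⇒≤ᴿ (map-eventually
      (λ {n} g≤1-α → ℚ.nonNegative⁻¹ _ {{ℚ.nonNeg*nonNeg⇒nonNeg (1ℚ ℚ.- seq α n)
        {{ℚ.nonNegative (ℚ.≤-trans (ℚ.<⇒≤ (ℚ.positive⁻¹ (gap α<1) {{gap-positive α<1}})) g≤1-α)}}
        r {{ℚ.pos⇒nonNeg r {{r>0}}}}}})
      (eventually-gap α<1))

    -- With q ≤ Dq = 1 - α this yields q ≤ α, which makes the excess α - q in the plan nonnegative.
    1-α≤α : 1ℝ -ᴿ α ≤ᴿ α
    1-α≤α = ≤ᴿ-trans (+ᴿ-cancelʳ-≤ α (begin
      (1ℝ -ᴿ α) +ᴿ α          ≈⟨ x-y+y≃x 1ℝ α ⟩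
      1ℝ                      ≈⟨ ≗⇒≃ᴿ (λ _ → refl) ⟨
      fromℚ ℚ.½ +ᴿ fromℚ ℚ.½  ≤⟨ +ᴿ-mono-≤ ≤ᴿ-refl ½≤α ⟩
      fromℚ ℚ.½ +ᴿ α          ∎)) ½≤α
      where
      open ≤ᴿ-Reasoning
      ½≤α : fromℚ ℚ.½ ≤ᴿ α
      ½≤α = ≤ᴿ-trans (≃ᴿ⇒≤ᴿ (≗⇒≃ᴿ λ _ → refl)) (<ᴿ⇒≤ᴿ ½<α)

    q≤α : q ≤ᴿ α
    q≤α = begin
      q           ≈⟨ +ᴿ-identityʳ q ⟨
      1 • q       ≤⟨ •-mono-≤ {1} {D} 0≤q (s≤s z≤n) ⟩
      D • q       ≈⟨ D•q≃1-α ⟩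
      1ℝ -ᴿ α     ≤⟨ 1-α≤α ⟩
      α           ∎
      where open ≤ᴿ-Reasoning

    open Plan α q 0≤q q≤α (<ᴿ⇒≤ᴿ α<1) using (source; target; S; w; isW₁)

    -- Splitting one q off the five leaves 4q + 2S = Dq = 1 - α, which joins α to give 1.
    w≃q+1 : w ≃ᴿ q +ᴿ 1ℝ
    w≃q+1 = begin
      α +ᴿ (5 • q +ᴿ (S +ᴿ S))
        ≈⟨ solve-+ᴿ 3 (λ a q S → a ⊕ ((q ⊕ (q ⊕ (q ⊕ (q ⊕ (q ⊕ 𝟘))))) ⊕ (S ⊕ S))
             ⊜ q ⊕ ((q ⊕ (q ⊕ (q ⊕ (q ⊕ (S ⊕ S))))) ⊕ a)) ≃ᴿ-refl α q S ⟩
      q +ᴿ ((q +ᴿ (q +ᴿ (q +ᴿ (q +ᴿ (S +ᴿ S))))) +ᴿ α)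
        ≈⟨ +ᴿ-congˡ (+ᴿ-congʳ (+ᴿ-congˡ (+ᴿ-congˡ (+ᴿ-congˡ (+ᴿ-congˡ (×-homo-+ q s s)))))) ⟨
      q +ᴿ (D • q +ᴿ α)
        ≈⟨ +ᴿ-congˡ (+ᴿ-congʳ D•q≃1-α) ⟩
      q +ᴿ ((1ℝ -ᴿ α) +ᴿ α)
        ≈⟨ +ᴿ-congˡ (x-y+y≃x 1ℝ α) ⟩
      q +ᴿ 1ℝ ∎
      where open ≃ᴿ-Reasoning

    instance
      degree-x₀≢0 : NonZero (SimpleGraph.degree G x₀)
      degree-x₀≢0 = SimpleGraph.degree≢0 G x₀∼y₀
      degree-y₀≢0 : NonZero (SimpleGraph.degree G y₀)
      degree-y₀≢0 = SimpleGraph.degree≢0 G (SimpleGraph.symmetric G x₀∼y₀)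

    adjacent : ∀ v .{{_ : NonZero (SimpleGraph.degree G (encode v))}} →
      SimpleGraph.degree G (encode v) ≡ D →
      ∀ w → ¬ v ≡ w → T (joined v w) → μ G α (encode v) (encode w) ≃ᴿ q
    adjacent v deg w v≢w j = ≡⇒≃ᴿ (trans (μ-adjacent G α (encode v) (encode-∼ v≢w j))
      (cong (λ r → (1ℝ -ᴿ α) *ᴿ fromℚ r) (1/-cong deg)))

    elsewhere : ∀ v .{{_ : NonZero (SimpleGraph.degree G (encode v))}} w → ¬ w ≡ v →
      ¬ T (joined v w) → μ G α (encode v) (encode w) ≃ᴿ 0ℝ
    elsewhere v w w≢v ¬j = ≡⇒≃ᴿ (μ-elsewhere G α (encode v)
      (λ eq → w≢v (encode-injective eq)) (λ v∼w → ¬j (∼-encode {v} {w} v∼w)))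

    μ-left : ∀ v → μ G α x₀ (encode v) ≃ᴿ source v
    μ-left left            = ≡⇒≃ᴿ (μ-self G α x₀)
    μ-left right           = adjacent left degree-left right (λ ()) _
    μ-left hub             = elsewhere left hub (λ ()) (λ ())
    μ-left (leftOnly i)    = adjacent left degree-left (leftOnly i) (λ ()) _
    μ-left (rightOnly i)   = elsewhere left (rightOnly i) (λ ()) (λ ())
    μ-left (common i)      = adjacent left degree-left (common i) (λ ()) _

    μ-right : ∀ v → μ G α y₀ (encode v) ≃ᴿ target v
    μ-right left           = adjacent right degree-right left (λ ()) _
    μ-right right          = ≡⇒≃ᴿ (μ-self G α y₀)
    μ-right hub            = elsewhere right hub (λ ()) (λ ())
    μ-right (leftOnly i)   = elsewhere right (leftOnly i) (λ ()) (λ ())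
    μ-right (rightOnly i)  = adjacent right degree-right (rightOnly i) (λ ()) _
    μ-right (common i)     = adjacent right degree-right (common i) (λ ()) _

    -q-isOllivierRicci : IsOllivierRicci G α x₀∼y₀ (-ᴿ q)
    -q-isOllivierRicci = w , isW₁ μ-left μ-right , x≃z+y⇒-z≃y-x w≃q+1

    -q/[1-α]≃κ : (-ᴿ q) *ᴿ recip (1ℝ -ᴿ α) (x<y⇒0<y-x α<1) ≃ᴿ κ
    -q/[1-α]≃κ = begin
      (-ᴿ q) *ᴿ 1/[1-α]                       ≈⟨ ≗⇒≃ᴿ (λ n → rearrange (1ℚ ℚ.- seq α n) r (seq 1/[1-α] n)) ⟩
      fromℚ (ℚ.- r) *ᴿ ((1ℝ -ᴿ α) *ᴿ 1/[1-α]) ≈⟨ fromℚ-*-cong (ℚ.- r) (*ᴿ-inverseʳ (1ℝ -ᴿ α) (x<y⇒0<y-x α<1)) ⟩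
      fromℚ (ℚ.- r) *ᴿ 1ℝ                     ≈⟨ ≗⇒≃ᴿ (λ _ → ℚ.*-identityʳ (ℚ.- r)) ⟩
      κ                                       ∎
      where
      open ≃ᴿ-Reasoning
      open +-*-Solver
      1/[1-α] : ℝ
      1/[1-α] = recip (1ℝ -ᴿ α) (x<y⇒0<y-x α<1)
      rearrange : ∀ a r i → (ℚ.- (a ℚ.* r)) ℚ.* i ≡ (ℚ.- r) ℚ.* (a ℚ.* i)
      rearrange = solve 3 (λ a r i → (:- (a :* r)) :* i := (:- r) :* (a :* i)) refl

  -- The quotient equals κ for every α strictly between 1/2 and 1, so δ = 1/2 works for all ε.
  κ-isLinLuYau : IsLinLuYau G x₀∼y₀ κ
  κ-isLinLuYau ε 0<ε = fromℚ ℚ.½ , mk< ℚ.½ _ (0 , λ _ _ → ℚ.≤-refl)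
    , λ α _ ½<α α<1 → -ᴿ q α ½<α α<1 , -q-isOllivierRicci α ½<α α<1
      , ≃ᴿ⇒-ε< (≃ᴿ-sym (-q/[1-α]≃κ α ½<α α<1)) 0<ε
      , ≃ᴿ⇒<+ε (-q/[1-α]≃κ α ½<α α<1) 0<ε

-- Arithmetic of the number of vertices

[2*order]/3 : ∀ s → (2 * order s) / 3 ≡ 6 ℕ.+ (s ℕ.+ s)
[2*order]/3 s = trans (cong (_/ 3) (triple s)) (m*n/n≡m (6 ℕ.+ (s ℕ.+ s)) 3)
  where
  open ℕ-Solver
  triple : ∀ s → 2 * order s ≡ (6 ℕ.+ (s ℕ.+ s)) * 3
  triple = solve 1 (λ s → con 2 :* (con 3 :+ ((con 3 :+ s) :+ ((con 3 :+ s) :+ s)))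
                       := (con 6 :+ (s :+ s)) :* con 3) refl

-- As 3 is coprime to 2, n = 3t; then 2n/3 = 2t is at least 6, so t ≥ 3 and s = t - 3.
3∣2n⇒order : ∀ n → 3 ∣ 2 * n → 6 ≤ (2 * n) / 3 → ∃ λ s → n ≡ order s
3∣2n⇒order n 3∣2n 6≤2n/3 with coprime-divisor {3} {2} {n} (from-yes (coprime? 3 2)) 3∣2n
... | divides t refl = t ∸ 3 , trans (cong (_* 3) (sym (ℕ.m+[n∸m]≡n 3≤t))) (unfold (t ∸ 3))
  where
  3≤t : 3 ≤ t
  3≤t = ℕ.*-cancelˡ-≤ 2 (subst (6 ≤_) (trans (cong (_/ 3) (sym (ℕ.*-assoc 2 t 3))) (m*n/n≡m (2 * t) 3)) 6≤2n/3)
  open ℕ-Solver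
  unfold : ∀ s → (3 ℕ.+ s) * 3 ≡ order s
  unfold = solve 1 (λ s → (con 3 :+ s) :* con 3 := con 3 :+ ((con 3 :+ s) :+ ((con 3 :+ s) :+ s))) refl

theorem1p2 : (n : ℕ) → 3 ∣ 2 * n → 2 ∣ (2 * n) / 3 → 6 ≤ (2 * n) / 3 →
    ∃ λ (G : SimpleGraph n) →
    SimpleGraph.minDegree G ≡ (2 * n) / 3 ∸ 2
    × (∃ λ x → ∃ λ y → Σ (SimpleGraph._∼_ G x y) λ x∼y →
    ∃ λ κ → IsLinLuYau G x∼y κ × κ Real.< Real.0ℝ)
theorem1p2 n 3∣2n _ 6≤2n/3 = attained n (3∣2n⇒order n 3∣2n 6≤2n/3)
  where
  attained : ∀ n → (∃ λ s → n ≡ order s) → ∃ λ (G : SimpleGraph n) →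
    SimpleGraph.minDegree G ≡ (2 * n) / 3 ∸ 2
    × (∃ λ x → ∃ λ y → Σ (SimpleGraph._∼_ G x y) λ x∼y →
       ∃ λ κ → IsLinLuYau G x∼y κ × κ <ᴿ 0ℝ)
  attained _ (s , refl) =
    Extremal.G s
    , trans (Extremal.minDegree≡D s) (sym (cong (_∸ 2) ([2*order]/3 s)))
    , Transport.x₀ s , Transport.y₀ s , Transport.x₀∼y₀ s
    , Curvature.κ s , Curvature.κ-isLinLuYau s , Curvature.κ<0 s
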